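{- For every natural number $n$, with all sums over pairs $(a,b)\in\mathbb{N}_0^2$ satisfying $a+2b=n$, $$\delta_4(n)=\frac14\sum_{a+2b=n}r_2(a)\,r_2(8b+2),$$ $$\delta_6(n)=\frac18\sum_{a+2b=n}r_3(a)\,r_3(8b+3),$$ $$\delta_8(n)=\sum_{a+2b=n}r_4(a)\,\sigma(2b+1),$$ $$\delta_{12}(n)=-\frac18\sum_{a+2b=n}r_6(a)\,\sigma_{2;\mathbf{1},\chi_{ -4}}(4b+3),$$ $$\delta_{16}(n)=\sum_{a+2b=n}r_8(a)\,\sigma_3^{\#}(b+1).$$
   Context: $\mathbb{N}_0=\{0,1,2,\dots\}$. $r_j(m)=\#\{\mathbf{y}\in\mathbb{Z}^j: m=\sum_{i=1}^j y_i^2\}$ and $\delta_j(m)=\#\{\mathbf{z}\in\mathbb{N}_0^j: m=\sum_{i=1}^j\frac{z_i(z_i+1)}{2}\}$. $\sigma(m)=\sum_{d\mid m}d$. $\sigma_3^{\#}(m)=\sum_{d\mid m,\ m/d\text{ odd}}d^3$. For primitive Dirichlet characters $\chi,\psi$, $\sigma_{k;\chi,\psi}(m)=\sum_{d\mid m}\psi(d)\chi(m/d)d^k$; $\mathbf{1}$ is the trivial character with $\mathbf{1}(m)=1$ for all $m\ge 1$, and $\chi_{ -4}$ is the odd Dirichlet character modulo $4$. -}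

module Defs where

open import Data.Nat as ℕ using (ℕ; zero; suc; _≤_; s≤s; z≤n)
import Data.Nat.Properties as ℕₚ
open import Data.Nat.DivMod using (/-monoˡ-≤; m*n/n≡m)
open import Data.Nat.Divisibility using (_∣_; _∣?_; divides; ∣⇒≤)
open import Data.Integer as ℤ using (ℤ; +_; -[1+_]; 0ℤ; 1ℤ; -1ℤ; ∣_∣)
import Data.Integer.Properties as ℤₚ
open import Algebra.Properties.AbelianGroup ℤₚ.+-0-abelianGroup using () renaming (∙-cancelʳ to +-cancelʳ)
open import Data.List as List using (List; []; _∷_; map; filter; length; upTo; cartesianProduct; cartesianProductWith)
open import Data.List.Membership.Propositional using (_∈_)
open import Data.List.Membership.Propositional.Properties
open import Data.List.Relation.Unary.Any using (here)
open import Data.List.Relation.Unary.Unique.Propositional using (Unique; []; _∷_)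
import Data.List.Relation.Unary.Unique.Propositional.Properties as Unique
import Data.List.Relation.Unary.All as All
open import Data.Nat.ListAction using (sum)
open import Data.Vec as Vec using (Vec; []; _∷_)
open import Data.Vec.Properties using (∷-injective)
open import Data.Vec.Relation.Unary.All using ([]; _∷_) renaming (All to VAll)
open import Data.Product using (_×_; _,_; proj₁; proj₂)
open import Function using (_∘_; _⇔_; mk⇔)
open import Relation.Nullary using (Dec)
open import Relation.Nullary.Decidable using (¬?)
open import Relation.Binary.PropositionalEquality

sumℤ : List ℤ → ℤ
sumℤ = List.foldr ℤ._+_ 0ℤ

vectors : ∀ {A : Set} → List A → ∀ j → List (Vec A j)
vectors xs zero    = [] ∷ []
vectors xs (suc j) = cartesianProductWith _∷_ xs (vectors xs j)

sumOfSquares : ∀ {j} → Vec ℤ j → ℤ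
sumOfSquares = Vec.foldr _ ℤ._+_ 0ℤ ∘ Vec.map (λ y → y ℤ.* y)

triangular : ℕ → ℕ
triangular z = (z ℕ.* suc z) ℕ./ 2

sumOfTriangulars : ∀ {j} → Vec ℕ j → ℕ
sumOfTriangulars = Vec.sum ∘ Vec.map triangular

-- The integers -m, …, m.
interval : ℕ → List ℤ
interval m = map (λ i → (+ i) ℤ.- (+ m)) (upTo (suc (2 ℕ.* m)))

-- Every solution of m = y₁² + ⋯ + yⱼ² lies in [-m , m]ʲ, since ∣y∣ ≤ y² on ℤ;
-- see ∈-squareSolutions and squareSolutions-unique below.
squareSolutions : ∀ j → ℕ → List (Vec ℤ j)
squareSolutions j m =
  filter (λ y → (+ m) ℤ.≟ sumOfSquares y) (vectors (interval m) j)

-- Every solution of m = z₁(z₁+1)/2 + ⋯ + zⱼ(zⱼ+1)/2 in ℕʲ lies in [0 , m]ʲ, since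
-- z ≤ z(z+1)/2; see ∈-triangularSolutions and triangularSolutions-unique below.
triangularSolutions : ∀ j → ℕ → List (Vec ℕ j)
triangularSolutions j m =
  filter (λ z → m ℕ.≟ sumOfTriangulars z) (vectors (upTo (suc m)) j)

r : ℕ → ℕ → ℕ
r j m = length (squareSolutions j m)

δ : ℕ → ℕ → ℕ
δ j m = length (triangularSolutions j m)

-- The positive divisors of m, for m ≥ 1.
divisors : ℕ → List ℕ
divisors m = filter (_∣? m) (map suc (upTo m))

-- Division made total; divisors never contains 0, so the first clause is only a
-- default value.
quotient : ℕ → ℕ → ℕ
quotient m zero      = 0
quotient m d@(suc _) = m ℕ./ d

σ : ℕ → ℕ
σ m = sum (divisors m)

σ₃# : ℕ → ℕ
σ₃# m = sum (map (ℕ._^ 3) (filter (λ d → ¬? (2 ∣? quotient m d)) (divisors m)))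

-- Only ℤ-valued characters are needed; they are represented by their values on ℕ.
𝟏 : ℕ → ℤ
𝟏 _ = 1ℤ

χ₋₄ : ℕ → ℤ
χ₋₄ 0 = 0ℤ
χ₋₄ 1 = 1ℤ
χ₋₄ 2 = 0ℤ
χ₋₄ 3 = -1ℤ
χ₋₄ (suc (suc (suc (suc m)))) = χ₋₄ m

σ[_⨾_,_] : ℕ → (ℕ → ℤ) → (ℕ → ℤ) → ℕ → ℤ
σ[ k ⨾ χ , ψ ] m =
  sumℤ (map (λ d → ψ d ℤ.* χ (quotient m d) ℤ.* (+ (d ℕ.^ k))) (divisors m))

-- The pairs (a , b) ∈ ℕ² with a + 2b = n; both entries are automatically ≤ n.
pairs : ℕ → List (ℕ × ℕ)
pairs n = filter (λ (a , b) → (a ℕ.+ 2 ℕ.* b) ℕ.≟ n)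
                 (cartesianProduct (upTo (suc n)) (upTo (suc n)))

-- The enumerations above are complete and free of repetition, so that their lengths
-- (respectively the sums over them) are those of the sets they stand for.

∈-vectors : ∀ {A : Set} {xs : List A} {j} {v : Vec A j} → VAll (_∈ xs) v → v ∈ vectors xs j
∈-vectors []       = here refl
∈-vectors (p ∷ ps) = ∈-cartesianProductWith⁺ _∷_ p (∈-vectors ps)

vectors-unique : ∀ {A : Set} {xs : List A} → Unique xs → ∀ j → Unique (vectors xs j)
vectors-unique u zero    = All.[] ∷ []
vectors-unique u (suc j) =
  Unique.cartesianProductWith⁺ _∷_ ∷-injective u (vectors-unique u j)

private
  n≤n*n : ∀ n → n ≤ n ℕ.* n
  n≤n*n zero    = z≤n
  n≤n*n (suc n) = ℕₚ.m≤m*n (suc n) (suc n)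

  n≤triangular : ∀ n → n ≤ triangular n
  n≤triangular zero    = z≤n
  n≤triangular (suc n) = subst (_≤ triangular (suc n)) (m*n/n≡m (suc n) 2)
    (/-monoˡ-≤ 2 (ℕₚ.*-monoʳ-≤ (suc n) (s≤s (s≤s (z≤n {n})))))

  natSquares : ∀ {j} → Vec ℤ j → ℕ
  natSquares = Vec.sum ∘ Vec.map (λ y → ∣ y ∣ ℕ.* ∣ y ∣)

  square-abs : ∀ y → y ℤ.* y ≡ + (∣ y ∣ ℕ.* ∣ y ∣)
  square-abs (+ n)    = sym (ℤₚ.pos-* n n)
  square-abs -[1+ n ] = refl

  sumOfSquares-nat : ∀ {j} (y : Vec ℤ j) → sumOfSquares y ≡ + natSquares y
  sumOfSquares-nat []       = refl
  sumOfSquares-nat (y ∷ ys) = cong₂ ℤ._+_ (square-abs y) (sumOfSquares-nat ys)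

  boundedBy : ∀ {A : Set} (f g : A → ℕ) → (∀ x → g x ≤ f x) →
              ∀ {j} (v : Vec A j) {m} → Vec.sum (Vec.map f v) ≤ m → VAll (λ x → g x ≤ m) v
  boundedBy f g le []       p = []
  boundedBy f g le (x ∷ xs) p =
    ℕₚ.≤-trans (le x) (ℕₚ.≤-trans (ℕₚ.m≤m+n (f x) _) p)
    ∷ boundedBy f g le xs (ℕₚ.≤-trans (ℕₚ.m≤n+m _ (f x)) p)

  mapAll : ∀ {A : Set} {P Q : A → Set} → (∀ {x} → P x → Q x) →
           ∀ {j} {v : Vec A j} → VAll P v → VAll Q v
  mapAll f []       = []
  mapAll f (p ∷ ps) = f p ∷ mapAll f ps

  interval-index : ∀ m y → ∣ y ∣ ≤ m → (+ ∣ y ℤ.+ (+ m) ∣) ≡ y ℤ.+ (+ m)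
  interval-index m (+ n)    _ = refl
  interval-index m -[1+ n ] p rewrite ℤₚ.⊖-≥ p = refl

∈-interval : ∀ {m y} → ∣ y ∣ ≤ m → y ∈ interval m
∈-interval {m} {y} p = subst (_∈ interval m) eq
  (∈-map⁺ (λ i → (+ i) ℤ.- (+ m)) (∈-upTo⁺ (s≤s bound)))
  where
  eq : (+ ∣ y ℤ.+ (+ m) ∣) ℤ.- (+ m) ≡ y
  eq = trans (cong (ℤ._- (+ m)) (interval-index m y p))
      (trans (ℤₚ.+-assoc y (+ m) (ℤ.- (+ m)))
      (trans (cong (λ k → y ℤ.+ k) (ℤₚ.+-inverseʳ (+ m))) (ℤₚ.+-identityʳ y)))
  bound : ∣ y ℤ.+ (+ m) ∣ ≤ 2 ℕ.* m
  bound = ℕₚ.≤-trans (ℤₚ.∣i+j∣≤∣i∣+∣j∣ y (+ m))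
    (subst (λ k → ∣ y ∣ ℕ.+ m ≤ m ℕ.+ k) (sym (ℕₚ.+-identityʳ m)) (ℕₚ.+-monoˡ-≤ m p))

interval-unique : ∀ m → Unique (interval m)
interval-unique m = Unique.map⁺
  (λ {i} {j} eq → ℤₚ.+-injective (+-cancelʳ (ℤ.- (+ m)) (+ i) (+ j) eq))
  (Unique.upTo⁺ _)

∈-squareSolutions : ∀ {j m} {y : Vec ℤ j} → y ∈ squareSolutions j m ⇔ + m ≡ sumOfSquares y
∈-squareSolutions {j} {m} {y} = mk⇔
  (proj₂ ∘ ∈-filter⁻ (λ y → (+ m) ℤ.≟ sumOfSquares y) {xs = vectors (interval m) j})
  (λ eq → ∈-filter⁺ (λ y → (+ m) ℤ.≟ sumOfSquares y)
    (∈-vectors (mapAll ∈-interval (boundedBy _ ∣_∣ (λ y → n≤n*n ∣ y ∣) y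
      (ℕₚ.≤-reflexive (sym (ℤₚ.+-injective (trans eq (sumOfSquares-nat y))))))))
    eq)

squareSolutions-unique : ∀ j m → Unique (squareSolutions j m)
squareSolutions-unique j m =
  Unique.filter⁺ (λ y → (+ m) ℤ.≟ sumOfSquares y) (vectors-unique (interval-unique m) j)

∈-triangularSolutions : ∀ {j m} {z : Vec ℕ j} →
                        z ∈ triangularSolutions j m ⇔ m ≡ sumOfTriangulars z
∈-triangularSolutions {j} {m} {z} = mk⇔
  (proj₂ ∘ ∈-filter⁻ (λ z → m ℕ.≟ sumOfTriangulars z) {xs = vectors (upTo (suc m)) j})
  (λ eq → ∈-filter⁺ (λ z → m ℕ.≟ sumOfTriangulars z)
    (∈-vectors (mapAll (∈-upTo⁺ ∘ s≤s)
      (boundedBy triangular (λ x → x) n≤triangular z (ℕₚ.≤-reflexive (sym eq)))))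
    eq)

triangularSolutions-unique : ∀ j m → Unique (triangularSolutions j m)
triangularSolutions-unique j m =
  Unique.filter⁺ (λ z → m ℕ.≟ sumOfTriangulars z) (vectors-unique (Unique.upTo⁺ _) j)

∈-divisors : ∀ {m d} → .{{ℕ.NonZero m}} → d ∈ divisors m ⇔ d ∣ m
∈-divisors {m} {d} = mk⇔
  (proj₂ ∘ ∈-filter⁻ (_∣? m) {xs = map suc (upTo m)})
  (λ d∣m → ∈-filter⁺ (_∣? m) (member d d∣m (∣⇒≤ d∣m)) d∣m)
  where
  member : ∀ d → d ∣ m → d ≤ m → d ∈ map suc (upTo m)
  member zero (divides q eq) _ with () ← ℕ.≢-nonZero⁻¹ m (trans eq (ℕₚ.*-zeroʳ q))
  member (suc d) _ d<m = ∈-map⁺ suc (∈-upTo⁺ d<m)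

divisors-unique : ∀ m → Unique (divisors m)
divisors-unique m = Unique.filter⁺ (_∣? m) (Unique.map⁺ ℕₚ.suc-injective (Unique.upTo⁺ m))

∈-pairs : ∀ {n a b} → (a , b) ∈ pairs n ⇔ a ℕ.+ 2 ℕ.* b ≡ n
∈-pairs {n} {a} {b} = mk⇔
  (proj₂ ∘ ∈-filter⁻ sums? {xs = cartesianProduct (upTo (suc n)) (upTo (suc n))})
  (λ eq → ∈-filter⁺ sums? (∈-cartesianProduct⁺
    (∈-upTo⁺ (s≤s (subst (a ≤_) eq (ℕₚ.m≤m+n a _))))
    (∈-upTo⁺ (s≤s (subst (b ≤_) eq
      (ℕₚ.≤-trans (ℕₚ.m≤m+n b _) (ℕₚ.m≤n+m (2 ℕ.* b) a)))))) eq)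
  where
  sums? : (p : ℕ × ℕ) → Dec (proj₁ p ℕ.+ 2 ℕ.* proj₂ p ≡ n)
  sums? (a , b) = (a ℕ.+ 2 ℕ.* b) ℕ.≟ n

pairs-unique : ∀ n → Unique (pairs n)
pairs-unique n = Unique.filter⁺ (λ (a , b) → (a ℕ.+ 2 ℕ.* b) ℕ.≟ n)
  (Unique.cartesianProduct⁺ (Unique.upTo⁺ (suc n)) (Unique.upTo⁺ (suc n)))

{-# OPTIONS --safe #-}

-- Since T(z + y) + T(z − y) = y² + 2 T(z), pairs of natural numbers correspond to pairs
-- (y , z) ∈ ℤ × ℕ, so δ₂ₖ(n) = Σ rₖ(a) δₖ(b) over a + 2b = n; it remains to identify δₖ(b).
-- For k = 2, 3 a solution of y₁² + ⋯ + yₖ² = 8b + k consists of odd integers.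
--
-- δ₄(n) = σ(2n + 1): by the symmetry of T(z₁) + ⋯ + T(z₅) = n, the series of δ₄ satisfies
-- Σ (n − 5 T(z)) δ₄(n − T(z)) = 0, which determines it from δ₄(0). For σ(2n + 1) the same
-- relation is a vanishing sum over the factorizations x² + 4de = 8n + 5, i.e. over the
-- indefinite forms d X² + x X Y − e Y², and follows from two involutions on these forms.
--
-- The other series follow from Liouville's identity
--   Σ (F(|a − b|) − F(a + b)) = Σ d (F(0) − F(2d)),
-- the left sum being over ax + by = 2m with a, b, x, y odd, the right one over de = m with
-- e odd. With F = [4 ∣ ·] it gives the square of the series of Σ χ₋₄(d), d ∣ 4n + 1, which
-- is that of δ₄ = δ₂ ∗ δ₂, and square roots are unique; with F(k) = k² it gives
-- δ₈ = δ₄ ∗ δ₄; with F(k) = [4 ∣ k] k² it gives the convolution of δ₂ with Σ χ₋₄(d) d²,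
-- d ∣ 4n + 3, as −8 δ₈ = −8 δ₂ ∗ δ₆, and δ₂ is cancelled.
module Submission where

open import Defs
open import Data.Bool using (Bool; true; false)
open import Data.Integer as ℤ using (ℤ; +_; -[1+_]; 0ℤ; 1ℤ)
import Data.Integer.Properties as ℤₚ
open import Data.Integer.Tactic.RingSolver using (solve-∀)
open import Data.List using (List; []; _∷_; map; filter; _++_; concatMap; length; upTo; cartesianProduct)
open import Data.List.Membership.Propositional using (_∈_)
open import Data.List.Membership.Propositional.Properties
open import Data.List.Membership.Propositional.Properties.WithK using (unique∧set⇒bag)
open import Data.List.Properties using (map-++; map-∘; length-upTo)
open import Data.List.Relation.Binary.BagAndSetEquality using (∼bag⇒↭)
open import Data.List.Relation.Binary.Permutation.Propositional using (_↭_; ↭⇒↭ₛ)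
import Data.List.Relation.Binary.Permutation.Propositional.Properties as ↭
import Data.List.Relation.Binary.Permutation.Setoid.Properties as ↭ₛ
import Data.List.Relation.Unary.All as All
import Data.List.Relation.Unary.All.Properties as All
open import Data.List.Relation.Unary.Any using (here; there)
open import Data.List.Relation.Unary.Unique.Propositional using (Unique; []; _∷_)
import Data.List.Relation.Unary.Unique.Propositional.Properties as Unique
import Data.Nat as ℕ
open import Data.Nat using (ℕ; zero; suc; _<_; _≤_; _+_; _*_; _∸_; s≤s; z≤n; _<?_; parity)
open import Data.Nat.DivMod using (m*n/n≡m)
open import Data.Nat.Divisibility using (_∣_; _∣?_; divides; ∣⇒≤; ∣m+n∣m⇒∣n)
open import Data.Nat.Induction using (<-rec)
open import Data.Nat.ListAction using (sum)
import Data.Nat.Properties as ℕₚ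
import Data.Nat.Tactic.RingSolver as ℕ-Solver
open import Data.Parity as ℙ using (0ℙ; 1ℙ)
import Data.Parity.Properties as ℙₚ
open import Data.Product using (_×_; _,_; proj₁; proj₂; ∃; ∃₂; map₁; swap)
open import Data.Rational as ℚ using (ℚ; _/_)
import Data.Rational.Properties as ℚₚ
import Data.Rational.Unnormalised as ℚᵘ
import Data.Rational.Unnormalised.Properties as ℚᵘₚ
open import Data.Sum using (_⊎_; inj₁; inj₂)
open import Data.Unit using (⊤; tt)
open import Data.Vec as Vec using (Vec; []; _∷_)
import Data.Vec.Properties as Vecₚ
open import Data.Vec.Relation.Unary.All using ([]; _∷_) renaming (All to VAll)
open import Function using (Equivalence; _∘_; mk⇔)
open import Relation.Binary.Consequences using (wlog)
open import Relation.Binary.PropositionalEquality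
open import Relation.Nullary using (¬_; yes; no; contradiction)
open import Relation.Nullary.Decidable using (¬?; _×-dec_)
open import Relation.Unary using (Decidable)
open import Algebra.Properties.AbelianGroup ℤₚ.+-0-abelianGroup using () renaming (∙-cancelʳ to +-cancelʳ)

open Equivalence using () renaming (to to ⇒; from to ⇐)

-- No power series occur: each identity between series is read off coefficientwise as an equality of
-- sums over finite sets of solutions, and is proved by bijections and sign-reversing involutions.
-- Division by a series becomes a recursion on coefficients. Liouville's identity relates divisor
-- sums to divisor sums only, so it cannot by itself say anything about `δ`; the evaluation of δ₄ is
-- what connects the two sides. The coefficient n - 5 T(z) there is a logarithmic derivative: for ψ
-- = Σ q^T(z) and f = ψ⁴ one has ψ · q f′ = 4 f · q ψ′, and comparing coefficients of qⁿ gives the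
-- weight (n - T(z)) - 4 T(z). All divisor sums are taken over factorizations d e = m with e odd.
-- This one index set serves the sums at odd arguments, where the condition on e is automatic, and
-- the sums of cubes, where it is the condition that m/d be odd.

private variable A B C I I′ : Set

-- Finite sums over enumerated sets

-- Only the elements are listed, without their proofs of `P`, so that `unique` counts each element
-- once even if `P` has several proofs. Any two enumerations of the same predicate are permutations
-- of each other, so a sum depends on `P` and the summand alone.
record Enumeration (P : A → Set) : Set where
  field
    elements : List A
    unique   : Unique elements
    sound    : ∀ {x} → x ∈ elements → P x
    complete : ∀ {x} → P x → x ∈ elements

open Enumeration

∑ : {P : A → Set} → Enumeration P → (A → ℤ) → ℤ
∑ E w = sumℤ (map w (elements E))

sumℤ-++ : ∀ xs ys → sumℤ (xs ++ ys) ≡ sumℤ xs ℤ.+ sumℤ ys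
sumℤ-++ []       ys = sym (ℤₚ.+-identityˡ _)
sumℤ-++ (x ∷ xs) ys = trans (cong (λ s → x ℤ.+ s) (sumℤ-++ xs ys)) (sym (ℤₚ.+-assoc x _ _))

sumℤ-↭ : ∀ {xs ys} → xs ↭ ys → sumℤ xs ≡ sumℤ ys
sumℤ-↭ p = ↭ₛ.foldr-commMonoid (setoid ℤ) ℤₚ.+-0-isCommutativeMonoid (↭⇒↭ₛ p)

map-cong-∈ : ∀ {w v : A → B} (xs : List A) → (∀ {x} → x ∈ xs → w x ≡ v x) → map w xs ≡ map v xs
map-cong-∈ []       eq = refl
map-cong-∈ (x ∷ xs) eq = cong₂ _∷_ (eq (here refl)) (map-cong-∈ xs (eq ∘ there))

map-unique : ∀ (f : A → B) {xs} → Unique xs →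
             (∀ {x y} → x ∈ xs → y ∈ xs → f x ≡ f y → x ≡ y) → Unique (map f xs)
map-unique f []       inj = []
map-unique f (x∉ ∷ u) inj =
  All.map⁺ (All.tabulate (λ y∈ eq → All.lookup x∉ y∈ (inj (here refl) (there y∈) eq)))
  ∷ map-unique f u (λ p q → inj (there p) (there q))

module _ {P : A → Set} (E : Enumeration P) where

  ∑-cong : ∀ {w v} → (∀ x → P x → w x ≡ v x) → ∑ E w ≡ ∑ E v
  ∑-cong eq = cong sumℤ (map-cong-∈ (elements E) (λ x∈ → eq _ (sound E x∈)))

  ∑-+ : ∀ w v → ∑ E (λ x → w x ℤ.+ v x) ≡ ∑ E w ℤ.+ ∑ E v
  ∑-+ w v = go (elements E)
    where
    interchange : ∀ a b c d → (a ℤ.+ b) ℤ.+ (c ℤ.+ d) ≡ (a ℤ.+ c) ℤ.+ (b ℤ.+ d)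
    interchange = solve-∀
    go : ∀ xs → sumℤ (map (λ x → w x ℤ.+ v x) xs) ≡ sumℤ (map w xs) ℤ.+ sumℤ (map v xs)
    go []       = refl
    go (x ∷ xs) = trans (cong (λ s → (w x ℤ.+ v x) ℤ.+ s) (go xs)) (interchange (w x) (v x) _ _)

  ∑-*ˡ : ∀ c w → ∑ E (λ x → c ℤ.* w x) ≡ c ℤ.* ∑ E w
  ∑-*ˡ c w = go (elements E)
    where
    go : ∀ xs → sumℤ (map (λ x → c ℤ.* w x) xs) ≡ c ℤ.* sumℤ (map w xs)
    go []       = sym (ℤₚ.*-zeroʳ c)
    go (x ∷ xs) = trans (cong (λ s → c ℤ.* w x ℤ.+ s) (go xs)) (sym (ℤₚ.*-distribˡ-+ c (w x) _))

  ∑-*ʳ : ∀ c w → ∑ E (λ x → w x ℤ.* c) ≡ ∑ E w ℤ.* c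
  ∑-*ʳ c w = trans (∑-cong (λ x _ → ℤₚ.*-comm (w x) c)) (trans (∑-*ˡ c w) (ℤₚ.*-comm c _))

  ∑-neg : ∀ w → ∑ E (λ x → ℤ.- w x) ≡ ℤ.- ∑ E w
  ∑-neg w = trans (∑-cong (λ x _ → sym (ℤₚ.-1*i≡-i (w x))))
    (trans (∑-*ˡ ℤ.-1ℤ w) (ℤₚ.-1*i≡-i _))

  ∑-- : ∀ w v → ∑ E (λ x → w x ℤ.- v x) ≡ ∑ E w ℤ.- ∑ E v
  ∑-- w v = trans (∑-+ w (ℤ.-_ ∘ v)) (cong (λ s → ∑ E w ℤ.+ s) (∑-neg v))

  -- Two duplicate-free lists with the same members are permutations of each other, and addition is
  -- commutative. Injectivity is asked only on `P`, since several of the maps forget data that the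
  -- defining equation restores.
  ∑-bij : {Q : B → Set} (F : Enumeration Q) (f : A → B) {w : A → ℤ} {v : B → ℤ} →
          (∀ x → P x → Q (f x)) →
          (∀ x y → P x → P y → f x ≡ f y → x ≡ y) →
          (∀ y → Q y → ∃ λ x → P x × f x ≡ y) →
          (∀ x → P x → w x ≡ v (f x)) → ∑ E w ≡ ∑ F v
  ∑-bij F f {w} {v} to inj surj eq = trans (∑-cong eq)
    (trans (cong sumℤ (map-∘ (elements E))) (sumℤ-↭ (↭.map⁺ v images)))
    where
    images : map f (elements E) ↭ elements F
    images = ∼bag⇒↭ (unique∧set⇒bag
      (map-unique f (unique E) (λ p q → inj _ _ (sound E p) (sound E q))) (unique F)
      (mk⇔ (λ y∈ → let x , x∈ , y≡ = ∈-map⁻ f y∈ in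
                   subst (_∈ elements F) (sym y≡) (complete F (to x (sound E x∈))))
           (λ y∈ → let x , px , fx≡ = surj _ (sound F y∈) in
                   subst (_∈ map f (elements E)) fx≡ (∈-map⁺ f (complete E px)))))

  ∑-inv : {Q : B → Set} (F : Enumeration Q) (f : A → B) (g : B → A) {w : A → ℤ} {v : B → ℤ} →
          (∀ x → P x → Q (f x)) → (∀ y → Q y → P (g y)) →
          (∀ x → P x → g (f x) ≡ x) → (∀ y → Q y → f (g y) ≡ y) →
          (∀ x → P x → w x ≡ v (f x)) → ∑ E w ≡ ∑ F v
  ∑-inv F f g to from gf fg = ∑-bij F f to
    (λ x y px py eq → trans (sym (gf x px)) (trans (cong g eq) (gf y py)))
    (λ y qy → g y , from y qy , fg y qy)

  restrict : {Q : A → Set} → Decidable Q → Enumeration (λ x → P x × Q x)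
  restrict Q? = record
    { elements = filter Q? (elements E)
    ; unique   = Unique.filter⁺ Q? (unique E)
    ; sound    = λ x∈ → map₁ (sound E) (∈-filter⁻ Q? x∈)
    ; complete = λ (px , qx) → ∈-filter⁺ Q? (complete E px) qx
    }

  ∑-split : {Q : A → Set} (Q? : Decidable Q) (w : A → ℤ) →
            ∑ E w ≡ ∑ (restrict Q?) w ℤ.+ ∑ (restrict (¬? ∘ Q?)) w
  ∑-split Q? w = go (elements E)
    where
    leftComm : ∀ a b c → a ℤ.+ (b ℤ.+ c) ≡ b ℤ.+ (a ℤ.+ c)
    leftComm = solve-∀
    go : ∀ xs → sumℤ (map w xs) ≡
         sumℤ (map w (filter Q? xs)) ℤ.+ sumℤ (map w (filter (¬? ∘ Q?) xs))
    go []       = refl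
    go (x ∷ xs) with Q? x
    ... | yes _ = trans (cong (λ s → w x ℤ.+ s) (go xs)) (sym (ℤₚ.+-assoc (w x) _ _))
    ... | no _  = trans (cong (λ s → w x ℤ.+ s) (go xs)) (leftComm (w x) (sumℤ (map w (filter Q? xs))) _)

  ∑-only : ∀ {w} x₀ → P x₀ → (∀ x → P x → x ≢ x₀ → w x ≡ 0ℤ) → ∑ E w ≡ w x₀
  ∑-only {w} x₀ px₀ zeros = go (elements E) (unique E) (complete E px₀) (λ x∈ → zeros _ (sound E x∈))
    where
    vanish : ∀ xs → (∀ {x} → x ∈ xs → w x ≡ 0ℤ) → sumℤ (map w xs) ≡ 0ℤ
    vanish []       z = refl
    vanish (x ∷ xs) z = cong₂ ℤ._+_ (z (here refl)) (vanish xs (z ∘ there))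
    go : ∀ xs → Unique xs → x₀ ∈ xs → (∀ {x} → x ∈ xs → x ≢ x₀ → w x ≡ 0ℤ) →
         sumℤ (map w xs) ≡ w x₀
    go (x ∷ xs) (x∉ ∷ u) (here refl) z =
      trans (cong (λ s → w x ℤ.+ s)
              (vanish xs (λ y∈ → z (there y∈) (λ y≡ → All.lookup x∉ y∈ (sym y≡)))))
            (ℤₚ.+-identityʳ _)
    go (x ∷ xs) (x∉ ∷ u) (there x₀∈) z =
      trans (cong₂ ℤ._+_ (z (here refl) (All.lookup x∉ x₀∈)) (go xs u x₀∈ (z ∘ there)))
            (ℤₚ.+-identityˡ _)

  module _ {Q : A → B → Set} (F : ∀ a → Enumeration (Q a)) where

    private
      fibre : A → List (A × B)
      fibre a = map (a ,_) (elements (F a))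

      fibres : List A → List (A × B)
      fibres = concatMap fibre

      ∈-fibres⁻ : ∀ xs {a b} → (a , b) ∈ fibres xs → a ∈ xs × Q a b
      ∈-fibres⁻ (x ∷ xs) p with ∈-++⁻ (fibre x) p
      ... | inj₁ q with _ , b∈ , refl ← ∈-map⁻ (x ,_) q = here refl , sound (F x) b∈
      ... | inj₂ q = map₁ there (∈-fibres⁻ xs q)

      ∈-fibres⁺ : ∀ {xs a b} → a ∈ xs → Q a b → (a , b) ∈ fibres xs
      ∈-fibres⁺ {x ∷ xs} (here refl) q = ∈-++⁺ˡ (∈-map⁺ (x ,_) (complete (F x) q))
      ∈-fibres⁺ {x ∷ xs} (there p)   q = ∈-++⁺ʳ (fibre x) (∈-fibres⁺ p q)

      fibres-unique : ∀ {xs} → Unique xs → Unique (fibres xs)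
      fibres-unique []       = []
      fibres-unique {x ∷ xs} (x∉ ∷ u) =
        Unique.++⁺ (Unique.map⁺ (cong proj₂) (unique (F x))) (fibres-unique u) disjoint
        where
        disjoint : ∀ {p} → ¬ (p ∈ fibre x × p ∈ fibres xs)
        disjoint (p , q) with _ , _ , refl ← ∈-map⁻ (x ,_) p =
          All.lookup x∉ (proj₁ (∈-fibres⁻ xs q)) refl

    bind : Enumeration (λ ((a , b) : A × B) → P a × Q a b)
    bind = record
      { elements = fibres (elements E)
      ; unique   = fibres-unique (unique E)
      ; sound    = λ x∈ → map₁ (sound E) (∈-fibres⁻ (elements E) x∈)
      ; complete = λ (pa , qb) → ∈-fibres⁺ (complete E pa) qb
      }

    ∑-bind : ∀ (w : A × B → ℤ) → ∑ bind w ≡ ∑ E (λ a → ∑ (F a) (λ b → w (a , b)))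
    ∑-bind w = go (elements E)
      where
      go : ∀ xs → sumℤ (map w (fibres xs)) ≡
           sumℤ (map (λ a → sumℤ (map (λ b → w (a , b)) (elements (F a)))) xs)
      go []       = refl
      go (x ∷ xs) = trans (cong sumℤ (map-++ w (fibre x) (fibres xs)))
        (trans (sumℤ-++ (map w (fibre x)) _)
          (cong₂ ℤ._+_ (cong sumℤ (sym (map-∘ (elements (F x))))) (go xs)))

fromBox : {P : A → Set} (xs : List A) → Unique xs → Decidable P → (∀ {x} → P x → x ∈ xs) → Enumeration P
fromBox xs u P? bound = record
  { elements = filter P? xs
  ; unique   = Unique.filter⁺ P? u
  ; sound    = λ x∈ → proj₂ (∈-filter⁻ P? {xs = xs} x∈)
  ; complete = λ px → ∈-filter⁺ P? (bound px) px
  }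

∑-cong-pred : {P Q : A → Set} (E : Enumeration P) (F : Enumeration Q) {w : A → ℤ} →
              (∀ {x} → P x → Q x) → (∀ {x} → Q x → P x) → ∑ E w ≡ ∑ F w
∑-cong-pred E F to from =
  ∑-inv E F (λ x → x) (λ x → x) (λ _ → to) (λ _ → from) (λ _ _ → refl) (λ _ _ → refl) (λ _ _ → refl)

-- A convolution-like sum of products of sums, flattened along h; keyP and keyQ say
-- that the summands of F and G carry their own index.
∑-conv : {L : I × I′ → Set} {P : I → B → Set} {Q : I′ → C → Set} {R : A → Set}
  (E : Enumeration L) (F : ∀ i → Enumeration (P i)) (G : ∀ j → Enumeration (Q j)) (K : Enumeration R)
  {w : B → ℤ} {v : C → ℤ} {u : A → ℤ} (h : B → C → A) →
  (keyP : ∀ {i i′ b} → P i b → P i′ b → i ≡ i′) →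
  (keyQ : ∀ {j j′ c} → Q j c → Q j′ c → j ≡ j′) →
  (to : ∀ {i j b c} → L (i , j) → P i b → Q j c → R (h b c)) →
  (inj : ∀ {b c b′ c′} → h b c ≡ h b′ c′ → b ≡ b′ × c ≡ c′) →
  (surj : ∀ {a} → R a → ∃₂ λ i j → ∃₂ λ b c → L (i , j) × P i b × Q j c × h b c ≡ a) →
  (∀ {i j b c} → L (i , j) → P i b → Q j c → w b ℤ.* v c ≡ u (h b c)) →
  ∑ E (λ (i , j) → ∑ (F i) w ℤ.* ∑ (G j) v) ≡ ∑ K u
∑-conv {P = P} {Q} E F G K {w} {v} h keyP keyQ to inj surj eq =
  trans (∑-cong E (λ (i , j) _ → sym (product i j)))
  (trans (sym (∑-bind E (λ (i , j) → bind (F i) (λ _ → G j)) (λ (_ , b , c) → w b ℤ.* v c)))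
  (∑-bij (bind E (λ (i , j) → bind (F i) (λ _ → G j))) K (λ (_ , b , c) → h b c)
    (λ _ (l , p , q) → to l p q)
    (λ _ _ (_ , p , q) (_ , p′ , q′) e → injective p q p′ q′ (inj e))
    (λ _ r → let i , j , b , c , l , p , q , e = surj r in
             ((i , j) , (b , c)) , (l , p , q) , e)
    (λ _ (l , p , q) → eq l p q)))
  where
  product : ∀ i j → ∑ (bind (F i) (λ _ → G j)) (λ (b , c) → w b ℤ.* v c) ≡ ∑ (F i) w ℤ.* ∑ (G j) v
  product i j = trans (∑-bind (F i) (λ _ → G j) _)
    (trans (∑-cong (F i) (λ b _ → ∑-*ˡ (G j) (w b) v)) (∑-*ʳ (F i) _ w))
  injective : ∀ {i j i′ j′ b c b′ c′} → P i b → Q j c → P i′ b′ → Q j′ c′ → b ≡ b′ × c ≡ c′ →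
              ((i , j) , (b , c)) ≡ ((i′ , j′) , (b′ , c′))
  injective p q p′ q′ (refl , refl) with refl ← keyP p p′ | refl ← keyQ q q′ = refl

-- Convolution of sequences

sumPairs : ∀ n → Enumeration (λ ((i , j) : ℕ × ℕ) → i ℕ.+ j ≡ n)
sumPairs n = fromBox (cartesianProduct (upTo (suc n)) (upTo (suc n)))
  (Unique.cartesianProduct⁺ (Unique.upTo⁺ (suc n)) (Unique.upTo⁺ (suc n)))
  (λ (i , j) → i ℕ.+ j ℕ.≟ n)
  (λ { {i , j} refl → ∈-cartesianProduct⁺ (∈-upTo⁺ (ℕ.s≤s (ℕₚ.m≤m+n i j))) (∈-upTo⁺ (ℕ.s≤s (ℕₚ.m≤n+m j i))) })

infixl 7 _∗_
_∗_ : (ℕ → ℤ) → (ℕ → ℤ) → ℕ → ℤ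
(f ∗ g) n = ∑ (sumPairs n) (λ (i , j) → f i ℤ.* g j)

∗-comm : ∀ f g n → (f ∗ g) n ≡ (g ∗ f) n
∗-comm f g n = ∑-inv (sumPairs n) (sumPairs n) swap swap
  (λ (i , j) e → trans (ℕₚ.+-comm j i) e) (λ (i , j) e → trans (ℕₚ.+-comm j i) e)
  (λ _ _ → refl) (λ _ _ → refl) (λ (i , j) _ → ℤₚ.*-comm (f i) (g j))

*-nonzeroʳ : ∀ i j → i ℤ.* j ≡ 0ℤ → j ≢ 0ℤ → i ≡ 0ℤ
*-nonzeroʳ i j eq j≢0 with ℤₚ.i*j≡0⇒i≡0∨j≡0 i eq
... | inj₁ i≡0 = i≡0
... | inj₂ j≡0 = contradiction j≡0 j≢0

-- The term with j = 0 determines f n from the values of f below n.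
recursion-unique : (f : ℕ → ℤ) (h : ℕ → ℕ → ℤ) →
  (∀ n → (f ∗ h n) n ≡ 0ℤ) →
  (∀ n → f n ≡ 0ℤ ⊎ h n 0 ≢ 0ℤ) → ∀ n → f n ≡ 0ℤ
recursion-unique f h rec leading = <-rec (λ n → f n ≡ 0ℤ) step
  where
  step : ∀ n → (∀ {i} → i < n → f i ≡ 0ℤ) → f n ≡ 0ℤ
  step n ih with leading n
  ... | inj₁ fn≡0 = fn≡0
  ... | inj₂ h≢0 = *-nonzeroʳ (f n) (h n 0)
    (trans (sym (∑-only (sumPairs n) (n , 0) (ℕₚ.+-identityʳ n) lower)) (rec n)) h≢0
    where
    lower : ∀ p → proj₁ p ℕ.+ proj₂ p ≡ n → p ≢ (n , 0) → f (proj₁ p) ℤ.* h n (proj₂ p) ≡ 0ℤ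
    lower (i , zero) e p≢ = contradiction (cong (_, 0) (trans (sym (ℕₚ.+-identityʳ i)) e)) p≢
    lower (i , suc j) e p≢ = cong (ℤ._* h n (suc j)) (ih (subst (i <_) e (ℕₚ.m<m+n i ℕₚ.0<1+n)))

∗-distribʳ-- : ∀ f g h n → ((λ i → f i ℤ.- g i) ∗ h) n ≡ (f ∗ h) n ℤ.- (g ∗ h) n
∗-distribʳ-- f g h n = trans (∑-cong (sumPairs n) (λ (i , j) _ → expand (f i) (g i) (h j)))
  (∑-- (sumPairs n) (λ (i , j) → f i ℤ.* h j) (λ (i , j) → g i ℤ.* h j))
  where
  expand : ∀ a b c → (a ℤ.- b) ℤ.* c ≡ a ℤ.* c ℤ.- b ℤ.* c
  expand = solve-∀

-- The difference f - g satisfies the homogeneous recursion with leading coefficient `h 0`.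
∗-cancelʳ : ∀ f g h → h 0 ≢ 0ℤ → (∀ n → (f ∗ h) n ≡ (g ∗ h) n) → ∀ n → f n ≡ g n
∗-cancelʳ f g h h0≢0 eq n = ℤₚ.i-j≡0⇒i≡j (f n) (g n)
  (recursion-unique (λ i → f i ℤ.- g i) (λ _ → h)
    (λ n → trans (∗-distribʳ-- f g h n) (ℤₚ.i≡j⇒i-j≡0 (eq n))) (λ _ → inj₂ h0≢0) n)

-- The difference of squares factors as (f - g) ∗ (f + g), and the second factor is cancelled. The
-- hypothesis at 0 excludes the other square root g = -f.
∗-square-injective : ∀ f g → f 0 ℤ.+ g 0 ≢ 0ℤ → (∀ n → (f ∗ f) n ≡ (g ∗ g) n) → ∀ n → f n ≡ g n
∗-square-injective f g nz eq = ∗-cancelʳ f g (λ j → f j ℤ.+ g j) nz (λ n →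
  trans (distrib f f g n)
  (trans (cong₂ ℤ._+_ (eq n) (∗-comm f g n))
  (trans (ℤₚ.+-comm ((g ∗ g) n) ((g ∗ f) n)) (sym (distrib g f g n)))))
  where
  distrib : ∀ f g h n → (f ∗ (λ j → g j ℤ.+ h j)) n ≡ (f ∗ g) n ℤ.+ (f ∗ h) n
  distrib f g h n = trans (∑-cong (sumPairs n) (λ (i , j) _ → ℤₚ.*-distribˡ-+ (f i) (g j) (h j)))
    (∑-+ (sumPairs n) _ _)

-- Liouville's identity

Odd Even : ℕ → Set
Odd n  = parity n ≡ 1ℙ
Even n = parity n ≡ 0ℙ

odd? : Decidable Odd
odd? n = parity n ℙₚ.≟ 1ℙ

even? : Decidable Even
even? n = parity n ℙₚ.≟ 0ℙ

odd⇒¬even : ∀ {n} → Odd n → ¬ Even n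
odd⇒¬even o e with () ← trans (sym o) e

¬odd⇒even : ∀ {n} → ¬ Odd n → Even n
¬odd⇒even {n} ¬o with parity n
... | 0ℙ = refl
... | 1ℙ = contradiction refl ¬o

odd+odd : ∀ m n → Odd m → Odd n → Even (m + n)
odd+odd m n p q = trans (ℙₚ.+-homo-+ m n) (cong₂ ℙ._+_ p q)

odd+even : ∀ m n → Odd m → Even n → Odd (m + n)
odd+even m n p q = trans (ℙₚ.+-homo-+ m n) (cong₂ ℙ._+_ p q)

even+odd : ∀ m n → Even m → Odd n → Odd (m + n)
even+odd m n p q = trans (ℙₚ.+-homo-+ m n) (cong₂ ℙ._+_ p q)

even∸odd : ∀ m n → n < m → Even m → Odd n → Odd (m ∸ n)
even∸odd m n n<m p q with parity (m ∸ n) in r | trans (sym (ℙₚ.+-homo-+ n (m ∸ n))) (trans (cong parity (ℕₚ.m+[n∸m]≡n (ℕₚ.<⇒≤ n<m))) p)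
... | 1ℙ | _ = refl
... | 0ℙ | s rewrite q with () ← s

odd∸odd : ∀ m n → n < m → Odd m → Odd n → Even (m ∸ n)
odd∸odd m n n<m p q with parity (m ∸ n) in r | trans (sym (ℙₚ.+-homo-+ n (m ∸ n))) (trans (cong parity (ℕₚ.m+[n∸m]≡n (ℕₚ.<⇒≤ n<m))) p)
... | 0ℙ | _ = refl
... | 1ℙ | s rewrite q with () ← s

odd∸even : ∀ m n → n < m → Odd m → Even n → Odd (m ∸ n)
odd∸even m n n<m p q with parity (m ∸ n) in r | trans (sym (ℙₚ.+-homo-+ n (m ∸ n))) (trans (cong parity (ℕₚ.m+[n∸m]≡n (ℕₚ.<⇒≤ n<m))) p)
... | 1ℙ | _ = refl
... | 0ℙ | s rewrite q with () ← s

odd-* : ∀ m n → Odd m → Odd n → Odd (m * n)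
odd-* m n p q = trans (ℙₚ.*-homo-* m n) (cong₂ ℙ._*_ p q)

odd-*⁻ˡ : ∀ m n → Odd (m * n) → Odd m
odd-*⁻ˡ m n p with parity m | trans (sym (ℙₚ.*-homo-* m n)) p
... | 1ℙ | _ = refl
... | 0ℙ | ()

odd-*⁻ʳ : ∀ m n → Odd (m * n) → Odd n
odd-*⁻ʳ m n p = odd-*⁻ˡ n m (trans (cong parity (ℕₚ.*-comm n m)) p)

odd⇒>0 : ∀ {n} → Odd n → 0 < n
odd⇒>0 {suc n} _ = ℕ.z<s

odd⇒1+2* : ∀ n → Odd n → ∃ λ k → n ≡ 1 + 2 * k
odd⇒1+2* (suc zero)    _ = 0 , refl
odd⇒1+2* (suc (suc n)) p with k , refl ← odd⇒1+2* n p = suc k , cong (suc ∘ suc) (sym (ℕₚ.+-suc k (k + 0)))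

even⇒2* : ∀ n → Even n → ∃ λ k → n ≡ 2 * k
even⇒2* zero          _ = 0 , refl
even⇒2* (suc (suc n)) p with k , refl ← even⇒2* n p = suc k , cong suc (sym (ℕₚ.+-suc k (k + 0)))

even-2* : ∀ k → Even (2 * k)
even-2* k = ℙₚ.*-homo-* 2 k

odd-1+2* : ∀ k → Odd (1 + 2 * k)
odd-1+2* k = trans (ℙₚ.+-homo-+ 1 (2 * k)) (cong (1ℙ ℙ.+_) (even-2* k))

module _ {P : A → Set} (E : Enumeration P) where

  ∑-trichotomy : (p q : A → ℕ) (w : A → ℤ) →
    ∑ E w ≡ ∑ (restrict E (λ x → p x <? q x)) w
            ℤ.+ (∑ (restrict E (λ x → q x <? p x)) w ℤ.+ ∑ (restrict E (λ x → p x ℕ.≟ q x)) w)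
  ∑-trichotomy p q w = trans (∑-split E (λ x → p x <? q x) w)
    (cong (λ s → ∑ (restrict E (λ x → p x <? q x)) w ℤ.+ s)
      (trans (∑-split rest (λ x → q x <? p x) w)
        (cong₂ ℤ._+_
          (∑-cong-pred (restrict rest (λ x → q x <? p x)) (restrict E (λ x → q x <? p x))
            (λ ((e , _) , gt) → e , gt) (λ (e , gt) → (e , ℕₚ.<⇒≯ gt) , gt))
          (∑-cong-pred (restrict rest (λ x → ¬? (q x <? p x))) (restrict E (λ x → p x ℕ.≟ q x))
            (λ ((e , p≮q) , q≮p) → e , ℕₚ.≤-antisym (ℕₚ.≮⇒≥ q≮p) (ℕₚ.≮⇒≥ p≮q))
            (λ (e , p≡q) → (e , λ lt → ℕₚ.<⇒≢ lt p≡q) , λ lt → ℕₚ.<⇒≢ lt (sym p≡q))))))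
    where
    rest = restrict E (λ x → ¬? (p x <? q x))

Quadruple : Set
Quadruple = (ℕ × ℕ) × (ℕ × ℕ)

form : Quadruple → ℕ
form ((a , x) , (b , y)) = a * x + b * y

swap-form : ∀ t → form (swap t) ≡ form t
swap-form ((a , x) , (b , y)) = ℕₚ.+-comm (b * y) (a * x)

OddQuadruple : ℕ → Quadruple → Set
OddQuadruple N t@((a , x) , (b , y)) = (Odd a × Odd x) × (Odd b × Odd y) × form t ≡ N

-- The common image of the off-diagonal substitutions in Liouville's identity: c stands for a - b or
-- a + b, and z for x + y or x - y respectively.
EvenOddQuadruple : ℕ → Quadruple → Set
EvenOddQuadruple N t@((c , y) , (a , z)) =
  ((0 < c × Even c) × Odd y) × (Odd a × (0 < z × Even z)) × form t ≡ N

quadruples : ∀ {P : Quadruple → Set} N → Decidable P →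
  (∀ {a x b y} → P ((a , x) , (b , y)) → 0 < a × 0 < x × 0 < b × 0 < y) →
  (∀ {t} → P t → form t ≡ N) → Enumeration P
quadruples {P} N P? positive size = fromBox box
  (Unique.cartesianProduct⁺ pairs! pairs!) P? bound
  where
  box = cartesianProduct (cartesianProduct (upTo (suc N)) (upTo (suc N)))
                         (cartesianProduct (upTo (suc N)) (upTo (suc N)))
  pairs! = Unique.cartesianProduct⁺ (Unique.upTo⁺ (suc N)) (Unique.upTo⁺ (suc N))
  factors : ∀ {a x} → 0 < a → 0 < x → a * x ≤ N →
            (a , x) ∈ cartesianProduct (upTo (suc N)) (upTo (suc N))
  factors {a} {x} a>0 x>0 le = ∈-cartesianProduct⁺
    (∈-upTo⁺ (s≤s (ℕₚ.≤-trans (ℕₚ.m≤m*n a x {{ℕ.>-nonZero x>0}}) le)))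
    (∈-upTo⁺ (s≤s (ℕₚ.≤-trans (ℕₚ.m≤n*m x a {{ℕ.>-nonZero a>0}}) le)))
  bound : ∀ {t} → P t → t ∈ box
  bound {(a , x) , (b , y)} p with a>0 , x>0 , b>0 , y>0 ← positive p =
    ∈-cartesianProduct⁺
      (factors a>0 x>0 (ℕₚ.≤-trans (ℕₚ.m≤m+n (a * x) (b * y)) (ℕₚ.≤-reflexive (size p))))
      (factors b>0 y>0 (ℕₚ.≤-trans (ℕₚ.m≤n+m (b * y) (a * x)) (ℕₚ.≤-reflexive (size p))))

oddQuadruples : ∀ N → Enumeration (OddQuadruple N)
oddQuadruples N = quadruples N
  (λ t@((a , x) , (b , y)) → (odd? a ×-dec odd? x) ×-dec (odd? b ×-dec odd? y) ×-dec (form t ℕ.≟ N))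
  (λ ((a , x) , (b , y) , _) → odd⇒>0 a , odd⇒>0 x , odd⇒>0 b , odd⇒>0 y)
  (λ (_ , _ , e) → e)

evenOddQuadruples : ∀ N → Enumeration (EvenOddQuadruple N)
evenOddQuadruples N = quadruples N
  (λ t@((c , y) , (a , z)) →
    ((0 <? c ×-dec even? c) ×-dec odd? y) ×-dec
    (odd? a ×-dec (0 <? z ×-dec even? z)) ×-dec (form t ℕ.≟ N))
  (λ (((c , _) , y) , (a , (z , _)) , _) → c , odd⇒>0 y , odd⇒>0 a , z)
  (λ (_ , _ , e) → e)

-- The divisors d of m with m/d odd, each stored with its cofactor, so that no division occurs in
-- the bijections.
OddCofactor : ℕ → ℕ × ℕ → Set
OddCofactor m (d , e) = 0 < d × Odd e × d * e ≡ m

oddCofactors : ∀ m → Enumeration (OddCofactor m)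
oddCofactors m = fromBox (cartesianProduct (upTo (suc m)) (upTo (suc m)))
  (Unique.cartesianProduct⁺ (Unique.upTo⁺ (suc m)) (Unique.upTo⁺ (suc m)))
  (λ (d , e) → 0 <? d ×-dec odd? e ×-dec (d * e ℕ.≟ m))
  λ { {d , e} (d>0 , oe , refl) → ∈-cartesianProduct⁺
      (∈-upTo⁺ (s≤s (ℕₚ.m≤m*n d e {{ℕ.>-nonZero (odd⇒>0 oe)}})))
      (∈-upTo⁺ (s≤s (ℕₚ.m≤n*m e d {{ℕ.>-nonZero d>0}}))) }

OddPair : ℕ → ℕ × ℕ → Set
OddPair d (p , q) = Odd p × Odd q × p + q ≡ 2 * d

oddPairs : ∀ d → Enumeration (OddPair d)
oddPairs d = fromBox (cartesianProduct (upTo (suc (2 * d))) (upTo (suc (2 * d))))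
  (Unique.cartesianProduct⁺ (Unique.upTo⁺ (suc (2 * d))) (Unique.upTo⁺ (suc (2 * d))))
  (λ (p , q) → odd? p ×-dec odd? q ×-dec (p + q ℕ.≟ 2 * d))
  λ { {p , q} (_ , _ , e) → ∈-cartesianProduct⁺
      (∈-upTo⁺ (s≤s (subst (p ≤_) e (ℕₚ.m≤m+n p q))))
      (∈-upTo⁺ (s≤s (subst (q ≤_) e (ℕₚ.m≤n+m q p)))) }

below : ∀ n → Enumeration (_< n)
below n = record { elements = upTo n ; unique = Unique.upTo⁺ n ; sound = ∈-upTo⁻ ; complete = ∈-upTo⁺ }

∑-1 : {P : A → Set} (E : Enumeration P) → ∑ E (λ _ → 1ℤ) ≡ + length (elements E)
∑-1 E = go (elements E)
  where
  go : (xs : List A) → sumℤ (map (λ _ → 1ℤ) xs) ≡ + length xs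
  go []       = refl
  go (x ∷ xs) = cong (λ s → 1ℤ ℤ.+ s) (go xs)

∑-below-1 : ∀ n → ∑ (below n) (λ _ → 1ℤ) ≡ + n
∑-below-1 n = trans (∑-1 (below n)) (cong +_ (length-upTo n))

∑-oddPairs-1 : ∀ d → ∑ (oddPairs d) (λ _ → 1ℤ) ≡ + d
∑-oddPairs-1 d = trans (sym (∑-bij (below d) (oddPairs d) (λ i → 1 + 2 * i , 1 + 2 * (d ∸ suc i))
  (λ i i<d → odd-1+2* i , odd-1+2* (d ∸ suc i) , trans (double i (d ∸ suc i)) (cong (2 *_) (ℕₚ.m+[n∸m]≡n i<d)))
  (λ i j _ _ e → ℕₚ.*-cancelˡ-≡ i j 2 (ℕₚ.suc-injective (cong proj₁ e)))
  surj (λ _ _ → refl))) (∑-below-1 d)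
  where
  double : ∀ i j → (1 + 2 * i) + (1 + 2 * j) ≡ 2 * (suc i + j)
  double = ℕ-Solver.solve-∀
  surj : ∀ pq → OddPair d pq → ∃ λ i → i < d × (1 + 2 * i , 1 + 2 * (d ∸ suc i)) ≡ pq
  surj (p , q) (op , oq , e) with i , refl ← odd⇒1+2* p op | j , refl ← odd⇒1+2* q oq
    with refl ← ℕₚ.*-cancelˡ-≡ d (suc i + j) 2 (trans (sym e) (double i j)) =
    i , s≤s (ℕₚ.m≤m+n i j) , cong (λ k → 1 + 2 * i , 1 + 2 * k) (ℕₚ.m+n∸m≡n i j)

-- With x = y = e the equation reads (p + q) e = 2m. Here p + q is even, say 2d, so d e = m; the d
-- ways to write 2d as a sum of two odd numbers give the factor d in Liouville's identity.
∑-diagonal : ∀ m {w : Quadruple → ℤ} {v : ℕ → ℤ} →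
  (∀ {p q d e} → p + q ≡ 2 * d → w ((p , e) , (q , e)) ≡ v d) →
  ∑ (restrict (oddQuadruples (2 * m)) (λ ((a , x) , (b , y)) → x ℕ.≟ y)) w
    ≡ ∑ (oddCofactors m) (λ (d , _) → + d ℤ.* v d)
∑-diagonal m {w} {v} eq = sym (trans
  (∑-cong (oddCofactors m) (λ (d , e) _ → sym (inner d)))
  (trans (sym (∑-bind (oddCofactors m) (λ (d , e) → oddPairs d) (λ ((d , _) , _) → 1ℤ ℤ.* v d)))
  (∑-bij (bind (oddCofactors m) (λ (d , e) → oddPairs d))
    (restrict (oddQuadruples (2 * m)) (λ ((a , x) , (b , y)) → x ℕ.≟ y))
    shape to inj surj
    (λ _ (_ , (_ , _ , pq)) → trans (ℤₚ.*-identityˡ _) (sym (eq pq))))))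
  where
  inner : ∀ d → ∑ (oddPairs d) (λ _ → 1ℤ ℤ.* v d) ≡ + d ℤ.* v d
  inner d = trans (∑-*ʳ (oddPairs d) (v d) (λ _ → 1ℤ)) (cong (ℤ._* v d) (∑-oddPairs-1 d))
  shape : (ℕ × ℕ) × (ℕ × ℕ) → Quadruple
  shape ((d , e) , (p , q)) = (p , e) , (q , e)
  Source : (ℕ × ℕ) × (ℕ × ℕ) → Set
  Source (de@(d , _) , pq) = OddCofactor m de × OddPair d pq
  Target : Quadruple → Set
  Target t@((_ , x) , (_ , y)) = OddQuadruple (2 * m) t × x ≡ y
  to : ∀ t → Source t → Target (shape t)
  to ((d , e) , (p , q)) ((d>0 , oe , de) , (op , oq , pq)) =
    ((op , oe) , (oq , oe) ,
     trans (sym (ℕₚ.*-distribʳ-+ e p q)) (trans (cong (_* e) pq) (trans (ℕₚ.*-assoc 2 d e) (cong (2 *_) de))))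
    , refl
  inj : ∀ t t′ → Source t → Source t′ → shape t ≡ shape t′ → t ≡ t′
  inj ((d , e) , (p , q)) ((d′ , e) , (p , q)) (_ , (_ , _ , pq)) (_ , (_ , _ , pq′)) refl
    with refl ← ℕₚ.*-cancelˡ-≡ d d′ 2 (trans (sym pq) pq′) = refl
  surj : ∀ t → Target t → ∃ λ s → Source s × shape s ≡ t
  surj ((a , x) , (b , x)) (((oa , ox) , (ob , _) , e) , refl)
    with d , a+b≡2d ← even⇒2* (a + b) (odd+odd a b oa ob) =
    ((d , x) , (a , b)) , ((d>0 , ox , de) , (oa , ob , a+b≡2d)) , refl
    where
    d>0 : 0 < d
    d>0 = ℕₚ.n≢0⇒n>0 λ { refl → ℕₚ.<⇒≢ (odd⇒>0 oa) (sym (ℕₚ.m+n≡0⇒m≡0 a a+b≡2d)) }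
    de : d * x ≡ m
    de = ℕₚ.*-cancelˡ-≡ (d * x) m 2 (trans (sym (ℕₚ.*-assoc 2 d x))
      (trans (cong (_* x) (sym a+b≡2d)) (trans (ℕₚ.*-distribʳ-+ x a b) e)))

module _ (N : ℕ) where

  private
    odds = oddQuadruples N
    evenOdds = evenOddQuadruples N

  -- Since a x + b y = (a - b) x + b (x + y), the inequality b < a becomes positivity of c, and x <
  -- x + y becomes the restriction on the image.
  ∑-odd-difference : (F : ℕ → ℤ) →
    ∑ (restrict odds (λ ((a , x) , (b , y)) → b <? a)) (λ ((a , x) , (b , y)) → F ℕ.∣ a - b ∣) ≡
    ∑ (restrict evenOdds (λ ((c , y) , (a , z)) → y <? z)) (λ ((c , y) , (a , z)) → F c)
  ∑-odd-difference F = ∑-inv (restrict odds _) (restrict evenOdds _)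
    (λ ((a , x) , (b , y)) → (a ∸ b , x) , (b , x + y))
    (λ ((c , y) , (a , z)) → (c + a , y) , (a , z ∸ y))
    (λ ((a , x) , (b , y)) (((oa , ox) , (ob , oy) , e) , b<a) →
      (((ℕₚ.m<n⇒0<n∸m b<a , odd∸odd a b b<a oa ob) , ox) ,
       (ob , (ℕₚ.≤-trans (odd⇒>0 ox) (ℕₚ.m≤m+n x y) , odd+odd x y ox oy)) ,
       trans (shear (a ∸ b) b x y) (trans (cong (λ k → k * x + b * y) (ℕₚ.m∸n+n≡m (ℕₚ.<⇒≤ b<a))) e))
      , ℕₚ.m<m+n x (odd⇒>0 oy))
    (λ ((c , y) , (a , z)) ((((c>0 , ec) , oy) , (oa , (z>0 , ez)) , e) , y<z) →
      ((even+odd c a ec oa , oy) , (oa , even∸odd z y y<z ez oy) ,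
       trans (sym (shear c a y (z ∸ y))) (trans (cong (λ k → c * y + a * k) (ℕₚ.m+[n∸m]≡n (ℕₚ.<⇒≤ y<z))) e))
      , ℕₚ.m<n+m a c>0)
    (λ ((a , x) , (b , y)) (_ , b<a) →
      cong₂ (λ a y → (a , x) , (b , y)) (ℕₚ.m∸n+n≡m (ℕₚ.<⇒≤ b<a)) (ℕₚ.m+n∸m≡n x y))
    (λ ((c , y) , (a , z)) (_ , y<z) →
      cong₂ (λ c z → (c , y) , (a , z)) (ℕₚ.m+n∸n≡m c a) (ℕₚ.m+[n∸m]≡n (ℕₚ.<⇒≤ y<z)))
    (λ ((a , x) , (b , y)) (_ , b<a) → cong F (ℕₚ.m≤n⇒∣n-m∣≡n∸m (ℕₚ.<⇒≤ b<a)))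
    where
    shear : ∀ c b x y → c * x + b * (x + y) ≡ (c + b) * x + b * y
    shear = ℕ-Solver.solve-∀

  -- Since a x + b y = (a + b) y + a (x - y), the inequality y < x becomes positivity of z, and a <
  -- a + b becomes the restriction on the image.
  ∑-odd-sum : (F : ℕ → ℤ) →
    ∑ (restrict odds (λ ((a , x) , (b , y)) → y <? x)) (λ ((a , x) , (b , y)) → F (a + b)) ≡
    ∑ (restrict evenOdds (λ ((c , y) , (a , z)) → a <? c)) (λ ((c , y) , (a , z)) → F c)
  ∑-odd-sum F = ∑-inv (restrict odds _) (restrict evenOdds _)
    (λ ((a , x) , (b , y)) → (a + b , y) , (a , x ∸ y))
    (λ ((c , y) , (a , z)) → (a , z + y) , (c ∸ a , y))
    (λ ((a , x) , (b , y)) (((oa , ox) , (ob , oy) , e) , y<x) →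
      (((ℕₚ.≤-trans (odd⇒>0 oa) (ℕₚ.m≤m+n a b) , odd+odd a b oa ob) , oy) ,
       (oa , (ℕₚ.m<n⇒0<n∸m y<x , odd∸odd x y y<x ox oy)) ,
       trans (shear a b y (x ∸ y)) (trans (cong (λ k → a * k + b * y) (ℕₚ.m∸n+n≡m (ℕₚ.<⇒≤ y<x))) e))
      , ℕₚ.m<m+n a (odd⇒>0 ob))
    (λ ((c , y) , (a , z)) ((((c>0 , ec) , oy) , (oa , (z>0 , ez)) , e) , a<c) →
      ((oa , even+odd z y ez oy) , (even∸odd c a a<c ec oa , oy) ,
       trans (sym (shear a (c ∸ a) y z)) (trans (cong (λ k → k * y + a * z) (ℕₚ.m+[n∸m]≡n (ℕₚ.<⇒≤ a<c))) e))
      , ℕₚ.m<n+m y z>0)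
    (λ ((a , x) , (b , y)) (_ , y<x) →
      cong₂ (λ b x → (a , x) , (b , y)) (ℕₚ.m+n∸m≡n a b) (ℕₚ.m∸n+n≡m (ℕₚ.<⇒≤ y<x)))
    (λ ((c , y) , (a , z)) (_ , a<c) →
      cong₂ (λ c z → (c , y) , (a , z)) (ℕₚ.m+[n∸m]≡n (ℕₚ.<⇒≤ a<c)) (ℕₚ.m+n∸n≡m z y))
    (λ _ _ → refl)
    where
    shear : ∀ a b y z → (a + b) * y + a * z ≡ a * (z + y) + b * y
    shear = ℕ-Solver.solve-∀

  -- Shifting a by c and y by z identifies the two complements.
  ∑-evenOdd : (F : ℕ → ℤ) →
    ∑ (restrict evenOdds (λ ((c , y) , (a , z)) → a <? c)) (λ ((c , y) , (a , z)) → F c) ≡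
    ∑ (restrict evenOdds (λ ((c , y) , (a , z)) → y <? z)) (λ ((c , y) , (a , z)) → F c)
  ∑-evenOdd F = +-cancelʳ (∑ (restrict evenOdds (λ ((c , y) , (a , z)) → ¬? (a <? c))) w) _ _
    (trans (sym (∑-split evenOdds (λ ((c , y) , (a , z)) → a <? c) w))
    (trans (∑-split evenOdds (λ ((c , y) , (a , z)) → y <? z) w)
      (cong (λ s → ∑ (restrict evenOdds (λ ((c , y) , (a , z)) → y <? z)) w ℤ.+ s) (sym complements))))
    where
    w : Quadruple → ℤ
    w ((c , y) , (a , z)) = F c
    shear : ∀ c y a z → c * (y + z) + a * z ≡ c * y + (a + c) * z
    shear = ℕ-Solver.solve-∀
    -- Opposite parities exclude equality, so on the complements the subtraction leaves a positive
    -- number.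
    strict : ∀ {c a} → Even c → Odd a → ¬ (a < c) → c < a
    strict {c} ec oa a≮c = ℕₚ.≤∧≢⇒< (ℕₚ.≮⇒≥ a≮c) λ { refl → odd⇒¬even {c} oa ec }
    complements : ∑ (restrict evenOdds (λ ((c , y) , (a , z)) → ¬? (a <? c))) w ≡
                  ∑ (restrict evenOdds (λ ((c , y) , (a , z)) → ¬? (y <? z))) w
    complements = ∑-inv (restrict evenOdds _) (restrict evenOdds _)
      (λ ((c , y) , (a , z)) → (c , y + z) , (a ∸ c , z))
      (λ ((c , y) , (a , z)) → (c , y ∸ z) , (a + c , z))
      (λ ((c , y) , (a , z)) ((((c>0 , ec) , oy) , (oa , (z>0 , ez)) , e) , a≮c) →
        let c<a = strict ec oa a≮c in
        (((c>0 , ec) , odd+even y z oy ez) , (odd∸even a c c<a oa ec , (z>0 , ez)) ,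
          trans (shear c y (a ∸ c) z)
            (trans (cong (λ k → c * y + k * z) (ℕₚ.m∸n+n≡m (ℕₚ.<⇒≤ c<a))) e))
        , ℕₚ.≤⇒≯ (ℕₚ.m≤n+m z y))
      (λ ((c , y) , (a , z)) ((((c>0 , ec) , oy) , (oa , (z>0 , ez)) , e) , y≮z) →
        let z<y = strict ez oy y≮z in
        (((c>0 , ec) , odd∸even y z z<y oy ez) , (odd+even a c oa ec , (z>0 , ez)) ,
          trans (sym (shear c (y ∸ z) a z))
            (trans (cong (λ k → c * k + a * z) (ℕₚ.m∸n+n≡m (ℕₚ.<⇒≤ z<y))) e))
        , ℕₚ.≤⇒≯ (ℕₚ.m≤n+m c a))
      (λ ((c , y) , (a , z)) (_ , a≮c) →
        cong₂ (λ y a → (c , y) , (a , z)) (ℕₚ.m+n∸n≡m y z) (ℕₚ.m∸n+n≡m (ℕₚ.≮⇒≥ a≮c)))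
      (λ ((c , y) , (a , z)) (_ , y≮z) →
        cong₂ (λ y a → (c , y) , (a , z)) (ℕₚ.m∸n+n≡m (ℕₚ.≮⇒≥ y≮z)) (ℕₚ.m+n∸n≡m a c))
      (λ _ _ → refl)

swap-odd : ∀ {N} t → OddQuadruple N t → OddQuadruple N (swap t)
swap-odd t (p , q , e) = q , p , trans (swap-form t) e

transpose : Quadruple → Quadruple
transpose ((a , x) , (b , y)) = (x , a) , (y , b)

-- Off the diagonals a = b and x = y both sums on the left become sums of F c over the
-- same set, so only the diagonal terms survive.
liouville : ∀ (F : ℕ → ℤ) m →
  ∑ (oddQuadruples (2 * m)) (λ ((a , _) , (b , _)) → F ℕ.∣ a - b ∣ ℤ.- F (a + b)) ≡
  ∑ (oddCofactors m) (λ (d , _) → + d ℤ.* (F 0 ℤ.- F (2 * d)))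
liouville F m = begin
  ∑ T (λ t → w₋ t ℤ.- w₊ t)
    ≡⟨ ∑-- T w₋ w₊ ⟩
  ∑ T w₋ ℤ.- ∑ T w₊
    ≡⟨ cong₂ ℤ._-_ (∑-trichotomy T first second w₋) (∑-trichotomy T first′ second′ w₊) ⟩
  (∑ T[a<b] w₋ ℤ.+ (∑ T[b<a] w₋ ℤ.+ ∑ T[a≡b] w₋)) ℤ.- (∑ T[x<y] w₊ ℤ.+ (∑ T[y<x] w₊ ℤ.+ ∑ T[x≡y] w₊))
    ≡⟨ cong₂ ℤ._-_
         (cong₂ ℤ._+_ (trans difference-swap b<a) (cong₂ ℤ._+_ b<a difference-diagonal))
         (cong₂ ℤ._+_ (trans sum-swap y<x) (cong₂ ℤ._+_ y<x sum-diagonal)) ⟩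
  (s ℤ.+ (s ℤ.+ ∑ D (λ (d , _) → + d ℤ.* F 0))) ℤ.- (s ℤ.+ (s ℤ.+ ∑ D (λ (d , _) → + d ℤ.* F (2 * d))))
    ≡⟨ cancel s _ _ ⟩
  ∑ D (λ (d , _) → + d ℤ.* F 0) ℤ.- ∑ D (λ (d , _) → + d ℤ.* F (2 * d))
    ≡⟨ ∑-- D _ _ ⟨
  ∑ D (λ (d , _) → + d ℤ.* F 0 ℤ.- + d ℤ.* F (2 * d))
    ≡⟨ ∑-cong D (λ (d , _) _ → sym (distrib (+ d) (F 0) (F (2 * d)))) ⟩
  ∑ D (λ (d , _) → + d ℤ.* (F 0 ℤ.- F (2 * d))) ∎
  where
  open ≡-Reasoning
  T = oddQuadruples (2 * m)
  U = evenOddQuadruples (2 * m)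
  D = oddCofactors m
  w₋ w₊ : Quadruple → ℤ
  w₋ ((a , _) , (b , _)) = F ℕ.∣ a - b ∣
  w₊ ((a , _) , (b , _)) = F (a + b)
  first second first′ second′ : Quadruple → ℕ
  first ((a , _) , _) = a
  second (_ , (b , _)) = b
  first′ ((_ , x) , _) = x
  second′ (_ , (_ , y)) = y
  T[a<b] = restrict T (λ t → first t <? second t)
  T[b<a] = restrict T (λ t → second t <? first t)
  T[a≡b] = restrict T (λ t → first t ℕ.≟ second t)
  T[x<y] = restrict T (λ t → first′ t <? second′ t)
  T[y<x] = restrict T (λ t → second′ t <? first′ t)
  T[x≡y] = restrict T (λ t → first′ t ℕ.≟ second′ t)
  s : ℤ
  s = ∑ (restrict U (λ ((c , y) , (a , z)) → y <? z)) (λ ((c , y) , (a , z)) → F c)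
  b<a : ∑ T[b<a] w₋ ≡ s
  b<a = ∑-odd-difference (2 * m) F
  y<x : ∑ T[y<x] w₊ ≡ s
  y<x = trans (∑-odd-sum (2 * m) F) (∑-evenOdd (2 * m) F)
  difference-swap : ∑ T[a<b] w₋ ≡ ∑ T[b<a] w₋
  difference-swap = ∑-inv T[a<b] T[b<a] swap swap
    (λ t (o , lt) → swap-odd t o , lt) (λ t (o , lt) → swap-odd t o , lt)
    (λ _ _ → refl) (λ _ _ → refl) (λ ((a , _) , (b , _)) _ → cong F (ℕₚ.∣-∣-comm a b))
  sum-swap : ∑ T[x<y] w₊ ≡ ∑ T[y<x] w₊
  sum-swap = ∑-inv T[x<y] T[y<x] swap swap
    (λ t (o , lt) → swap-odd t o , lt) (λ t (o , lt) → swap-odd t o , lt)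
    (λ _ _ → refl) (λ _ _ → refl) (λ ((a , _) , (b , _)) _ → cong F (ℕₚ.+-comm a b))
  transpose-form : ∀ t → form (transpose t) ≡ form t
  transpose-form ((a , x) , (b , y)) = cong₂ _+_ (ℕₚ.*-comm x a) (ℕₚ.*-comm y b)
  transpose-odd : ∀ t → OddQuadruple (2 * m) t → OddQuadruple (2 * m) (transpose t)
  transpose-odd t (p , q , e) = swap p , swap q , trans (transpose-form t) e
  -- On a = b the summand is the constant `F 0`, so exchanging a with x and b with y moves the sum
  -- to the diagonal x = y.
  difference-diagonal : ∑ T[a≡b] w₋ ≡ ∑ D (λ (d , _) → + d ℤ.* F 0)
  difference-diagonal = trans
    (∑-inv T[a≡b] T[x≡y] transpose transpose {v = λ _ → F 0}
      (λ t (o , eq) → transpose-odd t o , eq) (λ t (o , eq) → transpose-odd t o , eq)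
      (λ _ _ → refl) (λ _ _ → refl)
      (λ ((a , _) , (b , _)) (_ , eq) → cong F (ℕₚ.m≡n⇒∣m-n∣≡0 eq)))
    (∑-diagonal m (λ _ → refl))
  sum-diagonal : ∑ T[x≡y] w₊ ≡ ∑ D (λ (d , _) → + d ℤ.* F (2 * d))
  sum-diagonal = ∑-diagonal m (cong F)
  cancel : ∀ s a b → (s ℤ.+ (s ℤ.+ a)) ℤ.- (s ℤ.+ (s ℤ.+ b)) ≡ a ℤ.- b
  cancel = solve-∀
  distrib : ∀ d a b → d ℤ.* (a ℤ.- b) ≡ d ℤ.* a ℤ.- d ℤ.* b
  distrib = solve-∀

-- Indefinite binary quadratic forms

i+i≡0⇒i≡0 : ∀ i → i ℤ.+ i ≡ 0ℤ → i ≡ 0ℤ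
i+i≡0⇒i≡0 i eq = *-nonzeroʳ i (+ 2) (trans (double i) eq) (λ ())
  where
  double : ∀ i → i ℤ.* + 2 ≡ i ℤ.+ i
  double = solve-∀

i≡-i⇒i≡0 : ∀ i → i ≡ ℤ.- i → i ≡ 0ℤ
i≡-i⇒i≡0 i eq = i+i≡0⇒i≡0 i (trans (cong (λ j → i ℤ.+ j) eq) (ℤₚ.+-inverseʳ i))

triangular-double : ∀ z → triangular z * 2 ≡ z * suc z
triangular-double z = trans (cong (λ k → k ℕ./ 2 * 2) (sym (sum-double z)))
  (trans (cong (_* 2) (m*n/n≡m (sum≤ z) 2)) (sum-double z))
  where
  sum≤ : ℕ → ℕ
  sum≤ zero    = 0
  sum≤ (suc z) = suc z + sum≤ z
  step : ∀ z → suc z * 2 + z * suc z ≡ suc z * suc (suc z)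
  step = ℕ-Solver.solve-∀
  sum-double : ∀ z → sum≤ z * 2 ≡ z * suc z
  sum-double zero    = refl
  sum-double (suc z) = trans (ℕₚ.*-distribʳ-+ 2 (suc z) (sum≤ z))
    (trans (cong (λ k → suc z * 2 + k) (sum-double z)) (step z))

odd-square : ∀ z → (1 + 2 * z) * (1 + 2 * z) ≡ 1 + 8 * triangular z
odd-square z = trans (expand z) (trans (cong (λ k → 1 + 4 * k) (sym (triangular-double z))) (regroup (triangular z)))
  where
  expand : ∀ z → (1 + 2 * z) * (1 + 2 * z) ≡ 1 + 4 * (z * suc z)
  expand = ℕ-Solver.solve-∀
  regroup : ∀ t → 1 + 4 * (t * 2) ≡ 1 + 8 * t
  regroup = ℕ-Solver.solve-∀

square-∣∣ : ∀ x → x ℤ.* x ≡ + (ℤ.∣ x ∣ * ℤ.∣ x ∣)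
square-∣∣ (+ n)    = sym (ℤₚ.pos-* n n)
square-∣∣ -[1+ n ] = refl

Triple : Set
Triple = ℤ × ℤ × ℤ

-- The indefinite binary quadratic forms d X² + x X Y − e Y² of discriminant m.
Indefinite : ℕ → Triple → Set
Indefinite m (x , d , e) = 0ℤ ℤ.< d × 0ℤ ℤ.< e × x ℤ.* x ℤ.+ + 4 ℤ.* (d ℤ.* e) ≡ + m

indefinite-ℕ : ∀ {m} x d e → x ℤ.* x ℤ.+ + 4 ℤ.* (+ d ℤ.* + e) ≡ + m → ℤ.∣ x ∣ * ℤ.∣ x ∣ + 4 * (d * e) ≡ m
indefinite-ℕ x d e eq = ℤₚ.+-injective (trans (cong₂ ℤ._+_ (sym (square-∣∣ x))
  (trans (ℤₚ.pos-* 4 (d * e)) (cong (λ k → + 4 ℤ.* k) (ℤₚ.pos-* d e)))) eq)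

indefinites : ∀ m → Enumeration (Indefinite m)
indefinites m = fromBox (cartesianProduct (interval m) (cartesianProduct (interval m) (interval m)))
  (Unique.cartesianProduct⁺ (interval-unique m) (Unique.cartesianProduct⁺ (interval-unique m) (interval-unique m)))
  (λ (x , d , e) → 0ℤ ℤ.<? d ×-dec 0ℤ ℤ.<? e ×-dec (x ℤ.* x ℤ.+ + 4 ℤ.* (d ℤ.* e) ℤ.≟ + m))
  bound
  where
  m≤m*m : ∀ k → k ≤ k * k
  m≤m*m zero    = z≤n
  m≤m*m (suc k) = ℕₚ.m≤m*n (suc k) (suc k)
  bound : ∀ {t} → Indefinite m t → t ∈ cartesianProduct (interval m) (cartesianProduct (interval m) (interval m))
  bound {x , + suc d , + suc e} (_ , _ , eq) = ∈-cartesianProduct⁺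
    (∈-interval (ℕₚ.≤-trans (m≤m*m ℤ.∣ x ∣) (ℕₚ.m+n≤o⇒m≤o _ total)))
    (∈-cartesianProduct⁺
      (∈-interval (ℕₚ.≤-trans (ℕₚ.m≤m*n (suc d) (suc e)) product))
      (∈-interval (ℕₚ.≤-trans (ℕₚ.m≤n*m (suc e) (suc d)) product)))
    where
    total : ℤ.∣ x ∣ * ℤ.∣ x ∣ + 4 * (suc d * suc e) ≤ m
    total = ℕₚ.≤-reflexive (indefinite-ℕ x (suc d) (suc e) eq)
    product : suc d * suc e ≤ m
    product = ℕₚ.≤-trans (ℕₚ.m≤n*m (suc d * suc e) 4) (ℕₚ.m+n≤o⇒n≤o (ℤ.∣ x ∣ * ℤ.∣ x ∣) total)
  bound {_ , + 0 , _} (ℤ.+<+ () , _)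
  bound {_ , + suc _ , + 0} (_ , ℤ.+<+ () , _)

<-shift : ∀ {i j} k {i′ j′} → i ℤ.< j → i ℤ.+ k ≡ i′ → j ℤ.+ k ≡ j′ → i′ ℤ.< j′
<-shift k i<j refl refl = ℤₚ.+-monoˡ-< k i<j

module _ (m : ℕ) where

  private
    Forms = indefinites m

    -- The value of the form at (1, 1) is d + x - e; the condition says that it is negative.
    reduced? : Decidable (λ ((x , d , e) : Triple) → d ℤ.+ x ℤ.< e)
    reduced? (x , d , e) = d ℤ.+ x ℤ.<? e

  -- In the basis (1, 0), (−1, −1): the values at (0, 1) and (1, 1) are exchanged, so the
  -- forms negative at both of these vectors are permuted.
  reflect : Triple → Triple
  reflect (x , d , e) = ℤ.- x ℤ.- + 2 ℤ.* d , d , e ℤ.- x ℤ.- d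

  -- For a form f this is -f(Y, X), whose value at (1, 1) is opposite to that of f; `exchange` is
  -- -f(Y, -X).
  rotate : Triple → Triple
  rotate (x , d , e) = ℤ.- x , e , d

  exchange : Triple → Triple
  exchange (x , d , e) = x , e , d

  private
    exchange-sound : ∀ t → Indefinite m t → Indefinite m (exchange t)
    exchange-sound (x , d , e) (d>0 , e>0 , eq) =
      e>0 , d>0 , trans (cong (λ k → x ℤ.* x ℤ.+ + 4 ℤ.* k) (ℤₚ.*-comm e d)) eq

    rotate-sound : ∀ t → Indefinite m t → Indefinite m (rotate t)
    rotate-sound (x , d , e) (d>0 , e>0 , eq) = e>0 , d>0 , trans (invariant x d e) eq
      where
      invariant : ∀ x d e → (ℤ.- x) ℤ.* (ℤ.- x) ℤ.+ + 4 ℤ.* (e ℤ.* d) ≡ x ℤ.* x ℤ.+ + 4 ℤ.* (d ℤ.* e)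
      invariant = solve-∀

    reflect-sound : ∀ t → Indefinite m t × proj₁ (proj₂ t) ℤ.+ proj₁ t ℤ.< proj₂ (proj₂ t) →
                    let (x , d , e) = reflect t in Indefinite m (reflect t) × d ℤ.+ x ℤ.< e
    reflect-sound (x , d , e) ((d>0 , e>0 , eq) , lt) =
      (d>0 , <-shift (ℤ.- (d ℤ.+ x)) lt (left d x) (right d x e) , trans (invariant x d e) eq) ,
      <-shift (ℤ.- x ℤ.- d) e>0 (left′ d x) (right′ d x e)
      where
      left : ∀ d x → (d ℤ.+ x) ℤ.+ (ℤ.- (d ℤ.+ x)) ≡ 0ℤ
      left d x = ℤₚ.+-inverseʳ (d ℤ.+ x)
      right : ∀ d x e → e ℤ.+ (ℤ.- (d ℤ.+ x)) ≡ e ℤ.- x ℤ.- d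
      right = solve-∀
      left′ : ∀ d x → 0ℤ ℤ.+ (ℤ.- x ℤ.- d) ≡ d ℤ.+ (ℤ.- x ℤ.- + 2 ℤ.* d)
      left′ = solve-∀
      right′ : ∀ d x e → e ℤ.+ (ℤ.- x ℤ.- d) ≡ e ℤ.- x ℤ.- d
      right′ = solve-∀
      invariant : ∀ x d e →
        (ℤ.- x ℤ.- + 2 ℤ.* d) ℤ.* (ℤ.- x ℤ.- + 2 ℤ.* d) ℤ.+ + 4 ℤ.* (d ℤ.* (e ℤ.- x ℤ.- d))
        ≡ x ℤ.* x ℤ.+ + 4 ℤ.* (d ℤ.* e)
      invariant = solve-∀

    reflect-involutive : ∀ t → reflect (reflect t) ≡ t
    reflect-involutive (x , d , e) = cong₂ (λ x e → x , d , e) (first x d) (third x d e)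
      where
      first : ∀ x d → ℤ.- (ℤ.- x ℤ.- + 2 ℤ.* d) ℤ.- + 2 ℤ.* d ≡ x
      first = solve-∀
      third : ∀ x d e → e ℤ.- x ℤ.- d ℤ.- (ℤ.- x ℤ.- + 2 ℤ.* d) ℤ.- d ≡ e
      third = solve-∀

  ∑-exchange : (w : Triple → ℤ) → ∑ Forms w ≡ ∑ Forms (w ∘ exchange)
  ∑-exchange w = sym (∑-inv Forms Forms exchange exchange exchange-sound exchange-sound
    (λ _ _ → refl) (λ _ _ → refl) (λ _ _ → refl))

  ∑-reflect-odd : (w : Triple → ℤ) → (∀ t → w (reflect t) ≡ ℤ.- w t) → ∑ (restrict Forms reduced?) w ≡ 0ℤ
  ∑-reflect-odd w odd = i≡-i⇒i≡0 _ (trans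
    (∑-inv (restrict Forms reduced?) (restrict Forms reduced?) reflect reflect {v = ℤ.-_ ∘ w}
      reflect-sound reflect-sound (λ t _ → reflect-involutive t) (λ t _ → reflect-involutive t)
      (λ t _ → trans (sym (ℤₚ.neg-involutive (w t))) (cong ℤ.-_ (sym (odd t)))))
    (∑-neg (restrict Forms reduced?) w))

  -- A form vanishing at (1, 1) has square discriminant (d + e)².
  ∑-rotate-even : (∀ k → k ℤ.* k ≢ + m) → (w : Triple → ℤ) → (∀ t → w (rotate t) ≡ w t) →
                  ∑ Forms w ≡ ∑ (restrict Forms reduced?) w ℤ.+ ∑ (restrict Forms reduced?) w
  ∑-rotate-even nonsquare w even = trans (∑-split Forms reduced? w)
    (cong (λ s → ∑ (restrict Forms reduced?) w ℤ.+ s)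
      (∑-inv (restrict Forms (¬? ∘ reduced?)) (restrict Forms reduced?) rotate rotate
        (λ t@(x , d , e) (s , ¬lt) → rotate-sound t s ,
          <-shift (ℤ.- x) (ℤₚ.≤∧≢⇒< (ℤₚ.≮⇒≥ ¬lt) (nonzero x d e s)) refl (cancel d x))
        (λ t@(x , d , e) (s , lt) → rotate-sound t s ,
          λ lt′ → ℤₚ.<-asym lt (<-shift x lt′ (cancel′ e x) refl))
        (λ (x , _) _ → cong (_, _) (ℤₚ.neg-involutive x))
        (λ (x , _) _ → cong (_, _) (ℤₚ.neg-involutive x))
        (λ t _ → sym (even t))))
    where
    cancel : ∀ d x → d ℤ.+ x ℤ.+ ℤ.- x ≡ d
    cancel = solve-∀
    cancel′ : ∀ d x → d ℤ.+ ℤ.- x ℤ.+ x ≡ d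
    cancel′ = solve-∀
    nonzero : ∀ x d e → Indefinite m (x , d , e) → e ≢ d ℤ.+ x
    nonzero x d _ (_ , _ , eq) refl = nonsquare (d ℤ.+ (d ℤ.+ x)) (trans (square x d) eq)
      where
      square : ∀ x d → (d ℤ.+ (d ℤ.+ x)) ℤ.* (d ℤ.+ (d ℤ.+ x)) ≡ x ℤ.* x ℤ.+ + 4 ℤ.* (d ℤ.* (d ℤ.+ x))
      square = solve-∀

module _ (m : ℕ) (nonsquare : ∀ k → k ℤ.* k ≢ + m) where

  private
    S = indefinites m
    S⁻ = restrict S (λ (x , d , e) → d ℤ.+ x ℤ.<? e)

    -- cubicOdd is the correction making cubicEven − cubicOdd odd under reflect; its own sum
    -- vanishes since it is odd under exchange.
    cubicEven cubicOdd : Triple → ℤ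
    cubicEven (x , d , e) = (d ℤ.* e ℤ.- x ℤ.* x) ℤ.* (d ℤ.+ e)
    cubicOdd (x , d , e) = x ℤ.* (d ℤ.* d ℤ.- e ℤ.* e)

    ∑cubicOdd≡0 : ∑ S cubicOdd ≡ 0ℤ
    ∑cubicOdd≡0 = i≡-i⇒i≡0 _ (trans (∑-exchange m cubicOdd)
      (trans (∑-cong S (λ (x , d , e) _ → odd x d e)) (∑-neg S cubicOdd)))
      where
      odd : ∀ x d e → x ℤ.* (e ℤ.* e ℤ.- d ℤ.* d) ≡ ℤ.- (x ℤ.* (d ℤ.* d ℤ.- e ℤ.* e))
      odd = solve-∀

    ∑[S⁻]cubicOdd≡0 : ∑ S⁻ cubicOdd ≡ 0ℤ
    ∑[S⁻]cubicOdd≡0 = i+i≡0⇒i≡0 _ (trans (sym (∑-rotate-even m nonsquare cubicOdd (λ (x , d , e) → even x d e))) ∑cubicOdd≡0)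
      where
      even : ∀ x d e → (ℤ.- x) ℤ.* (e ℤ.* e ℤ.- d ℤ.* d) ≡ x ℤ.* (d ℤ.* d ℤ.- e ℤ.* e)
      even = solve-∀

    ∑[S⁻]cubicEven≡∑[S⁻]cubicOdd : ∑ S⁻ cubicEven ≡ ∑ S⁻ cubicOdd
    ∑[S⁻]cubicEven≡∑[S⁻]cubicOdd = ℤₚ.i-j≡0⇒i≡j _ _ (trans (sym (∑-- S⁻ cubicEven cubicOdd))
      (∑-reflect-odd m (λ t → cubicEven t ℤ.- cubicOdd t) (λ (x , d , e) → odd x d e)))
      where
      odd : ∀ x d e → cubicEven (reflect m (x , d , e)) ℤ.- cubicOdd (reflect m (x , d , e)) ≡
            ℤ.- (cubicEven (x , d , e) ℤ.- cubicOdd (x , d , e))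
      odd = identity
        where
        identity : ∀ x d e →
          (d ℤ.* (e ℤ.- x ℤ.- d) ℤ.- (ℤ.- x ℤ.- + 2 ℤ.* d) ℤ.* (ℤ.- x ℤ.- + 2 ℤ.* d)) ℤ.* (d ℤ.+ (e ℤ.- x ℤ.- d))
            ℤ.- (ℤ.- x ℤ.- + 2 ℤ.* d) ℤ.* (d ℤ.* d ℤ.- (e ℤ.- x ℤ.- d) ℤ.* (e ℤ.- x ℤ.- d)) ≡
          ℤ.- ((d ℤ.* e ℤ.- x ℤ.* x) ℤ.* (d ℤ.+ e) ℤ.- x ℤ.* (d ℤ.* d ℤ.- e ℤ.* e))
        identity = solve-∀

    -- Both cubics are invariant under `rotate`, so each sum over `S` is twice the sum over `S⁻`.
    -- There `reflect` makes the two sums equal, and the one for `cubicOdd` is already known to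
    -- vanish.
    ∑cubicEven≡0 : ∑ S cubicEven ≡ 0ℤ
    ∑cubicEven≡0 = trans (∑-rotate-even m nonsquare cubicEven (λ (x , d , e) → even x d e))
      (cong₂ ℤ._+_ ∑[S⁻]cubicEven≡0 ∑[S⁻]cubicEven≡0)
      where
      ∑[S⁻]cubicEven≡0 = trans ∑[S⁻]cubicEven≡∑[S⁻]cubicOdd ∑[S⁻]cubicOdd≡0
      even : ∀ x d e → (e ℤ.* d ℤ.- (ℤ.- x) ℤ.* (ℤ.- x)) ℤ.* (e ℤ.+ d) ≡ (d ℤ.* e ℤ.- x ℤ.* x) ℤ.* (d ℤ.+ e)
      even = solve-∀

  -- For m = 8n + 5 and x = 2z + 1 the second factor equals 8 (n - 5 T(z)), the coefficient in the
  -- recursion for δ₄.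
  weight : Triple → ℤ
  weight (x , d , e) = d ℤ.* (+ m ℤ.- + 5 ℤ.* (x ℤ.* x))

  ∑-weight : ∑ S weight ≡ 0ℤ
  ∑-weight = i+i≡0⇒i≡0 _ (begin
    ∑ S weight ℤ.+ ∑ S weight
      ≡⟨ cong (λ s → ∑ S weight ℤ.+ s) (∑-exchange m weight) ⟩
    -- On these forms m - 5x² = 4 (d e - x²), so adding the exchanged weight produces the factor d +
    -- e of `cubicEven`.
    ∑ S weight ℤ.+ ∑ S (weight ∘ exchange m)
      ≡⟨ ∑-+ S weight (weight ∘ exchange m) ⟨
    ∑ S (λ t → weight t ℤ.+ weight (exchange m t))
      ≡⟨ ∑-cong S symmetrize ⟩
    ∑ S (λ t → + 4 ℤ.* cubicEven t)
      ≡⟨ ∑-*ˡ S (+ 4) cubicEven ⟩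
    + 4 ℤ.* ∑ S cubicEven
      ≡⟨ cong (λ s → + 4 ℤ.* s) ∑cubicEven≡0 ⟩
    0ℤ ∎)
    where
    open ≡-Reasoning
    expand : ∀ x d e →
      d ℤ.* (x ℤ.* x ℤ.+ + 4 ℤ.* (d ℤ.* e) ℤ.- + 5 ℤ.* (x ℤ.* x)) ℤ.+
      e ℤ.* (x ℤ.* x ℤ.+ + 4 ℤ.* (d ℤ.* e) ℤ.- + 5 ℤ.* (x ℤ.* x)) ≡
      + 4 ℤ.* ((d ℤ.* e ℤ.- x ℤ.* x) ℤ.* (d ℤ.+ e))
    expand = solve-∀
    symmetrize : ∀ t → Indefinite m t → weight t ℤ.+ weight (exchange m t) ≡ + 4 ℤ.* cubicEven t
    symmetrize (x , d , e) (_ , _ , eq) = trans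
      (cong (λ k → d ℤ.* (k ℤ.- + 5 ℤ.* (x ℤ.* x)) ℤ.+ e ℤ.* (k ℤ.- + 5 ℤ.* (x ℤ.* x))) (sym eq))
      (expand x d e)

  -- The weight is even in x, and x = 0 would give 4 d e = m; the part with x > 0 is therefore half
  -- of the full sum. Positive odd x are the 2z + 1 with z in ℕ.
  ∑-weight-positive : (∀ d e → + 4 ℤ.* (d ℤ.* e) ≢ + m) →
    ∑ (restrict S (λ (x , _) → 0ℤ ℤ.<? x)) weight ≡ 0ℤ
  ∑-weight-positive ¬4∣m = i+i≡0⇒i≡0 _ (trans
    (cong (λ s → ∑ (restrict S (λ (x , _) → 0ℤ ℤ.<? x)) weight ℤ.+ s) (sym negatives))
    (trans (sym (∑-split S (λ (x , _) → 0ℤ ℤ.<? x) weight)) ∑-weight))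
    where
    negate : Triple → Triple
    negate (x , d , e) = ℤ.- x , d , e
    even : ∀ x → (ℤ.- x) ℤ.* (ℤ.- x) ≡ x ℤ.* x
    even = solve-∀
    negate-sound : ∀ t → Indefinite m t → Indefinite m (negate t)
    negate-sound (x , d , e) (d>0 , e>0 , eq) = d>0 , e>0 , trans (cong (ℤ._+ + 4 ℤ.* (d ℤ.* e)) (even x)) eq
    nonzero : ∀ {x d e} → Indefinite m (x , d , e) → x ≢ 0ℤ
    nonzero {d = d} {e} (_ , _ , eq) refl = ¬4∣m d e (trans (sym (ℤₚ.+-identityˡ _)) eq)
    negatives : ∑ (restrict S (λ (x , _) → ¬? (0ℤ ℤ.<? x))) weight ≡ ∑ (restrict S (λ (x , _) → 0ℤ ℤ.<? x)) weight
    negatives = ∑-inv (restrict S _) (restrict S _) negate negate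
      (λ t (s , x≯0) → negate-sound t s , ℤₚ.neg-mono-< (ℤₚ.≤∧≢⇒< (ℤₚ.≮⇒≥ x≯0) (nonzero s)))
      (λ t (s , x>0) → negate-sound t s , ℤₚ.<-asym (ℤₚ.neg-mono-< x>0))
      (λ (x , _) _ → cong (_, _) (ℤₚ.neg-involutive x))
      (λ (x , _) _ → cong (_, _) (ℤₚ.neg-involutive x))
      (λ (x , d , e) _ → cong (λ k → d ℤ.* (+ m ℤ.- + 5 ℤ.* k)) (sym (even x)))

-- Sums of four triangular numbers

triangularVectors : ∀ k n → Enumeration (λ (z : Vec ℕ k) → n ≡ sumOfTriangulars z)
triangularVectors k n = record
  { elements = triangularSolutions k n
  ; unique   = triangularSolutions-unique k n
  ; sound    = ⇒ ∈-triangularSolutions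
  ; complete = ⇐ ∈-triangularSolutions
  }

squareVectors : ∀ k n → Enumeration (λ (y : Vec ℤ k) → + n ≡ sumOfSquares y)
squareVectors k n = record
  { elements = squareSolutions k n
  ; unique   = squareSolutions-unique k n
  ; sound    = ⇒ ∈-squareSolutions
  ; complete = ⇐ ∈-squareSolutions
  }

δᶻ rᶻ : ℕ → ℕ → ℤ
δᶻ k n = + δ k n
rᶻ k n = + r k n

sumOfTriangulars-++ : ∀ {j k} (v : Vec ℕ j) (w : Vec ℕ k) →
  sumOfTriangulars (v Vec.++ w) ≡ sumOfTriangulars v + sumOfTriangulars w
sumOfTriangulars-++ []       w = refl
sumOfTriangulars-++ (z ∷ v) w =
  trans (cong (λ s → triangular z + s) (sumOfTriangulars-++ v w)) (sym (ℕₚ.+-assoc (triangular z) _ _))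

module _ (j k n : ℕ) (w : Vec ℕ j → ℤ) (v : Vec ℕ k → ℤ) (u : Vec ℕ (j + k) → ℤ)
  (eq : ∀ x y → w x ℤ.* v y ≡ u (x Vec.++ y)) where

  ∑-++ : ∑ (sumPairs n) (λ (i , l) → ∑ (triangularVectors j i) w ℤ.* ∑ (triangularVectors k l) v) ≡
         ∑ (triangularVectors (j + k) n) u
  ∑-++ = ∑-conv (sumPairs n) (triangularVectors j) (triangularVectors k) (triangularVectors (j + k) n) Vec._++_
    (λ p q → trans p (sym q)) (λ p q → trans p (sym q))
    (λ { {b = x} {y} refl refl refl → sym (sumOfTriangulars-++ x y) })
    (λ {x} {_} {x′} e → Vecₚ.++-injective x x′ e)
    (λ {a} e → let x , y , a≡ = Vec.splitAt j a in
      sumOfTriangulars x , sumOfTriangulars y , x , y ,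
      sym (trans e (trans (cong sumOfTriangulars a≡) (sumOfTriangulars-++ x y))) , refl , refl , sym a≡)
    (λ {b = x} {y} _ _ _ → eq x y)

δ-∗ : ∀ j k n → (δᶻ j ∗ δᶻ k) n ≡ δᶻ (j + k) n
δ-∗ j k n = trans
  (∑-cong (sumPairs n) (λ (i , l) _ → cong₂ ℤ._*_ (sym (∑-1 (triangularVectors j i))) (sym (∑-1 (triangularVectors k l)))))
  (trans (∑-++ j k n (λ _ → 1ℤ) (λ _ → 1ℤ) (λ _ → 1ℤ) (λ _ _ → refl)) (∑-1 (triangularVectors (j + k) n)))

-- The factor 8 matches `weight`. The sum has at most one term; writing it over vectors of length
-- one lets `∑-++` join it to the four remaining coordinates.
weighted : ℕ → ℕ → ℤ
weighted n j = ∑ (triangularVectors 1 j) (λ z → + 8 ℤ.* (+ n ℤ.- + 5 ℤ.* + sumOfTriangulars z))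

-- Cyclically permuting the five coordinates, the sum of 5 T(z₁) over all solutions of
-- T(z₁) + ⋯ + T(z₅) = n is n times their number.
δ₄-recursion : ∀ n → (weighted n ∗ δᶻ 4) n ≡ 0ℤ
δ₄-recursion n = begin
  (weighted n ∗ δᶻ 4) n
    ≡⟨ ∑-cong (sumPairs n) (λ (i , j) _ → cong (λ s → weighted n i ℤ.* s) (sym (∑-1 (triangularVectors 4 j)))) ⟩
  ∑ (sumPairs n) (λ (i , j) → weighted n i ℤ.* ∑ (triangularVectors 4 j) (λ _ → 1ℤ))
    ≡⟨ ∑-++ 1 4 n (λ z → + 8 ℤ.* (+ n ℤ.- + 5 ℤ.* + sumOfTriangulars z)) (λ _ → 1ℤ)
         (λ v → + 8 ℤ.* (+ n ℤ.- + 5 ℤ.* first v))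
         (λ { (z ∷ []) _ → trans (ℤₚ.*-identityʳ _) (cong (λ t → + 8 ℤ.* (+ n ℤ.- + 5 ℤ.* + t)) (ℕₚ.+-identityʳ (triangular z))) }) ⟩
  ∑ K (λ v → + 8 ℤ.* (+ n ℤ.- + 5 ℤ.* first v))
    ≡⟨ ∑-*ˡ K (+ 8) _ ⟩
  + 8 ℤ.* ∑ K (λ v → + n ℤ.- + 5 ℤ.* first v)
    ≡⟨ cong (λ s → + 8 ℤ.* s) (trans (∑-- K _ _) (cong₂ ℤ._-_ total (∑-*ˡ K (+ 5) first))) ⟩
  + 8 ℤ.* (s ℤ.+ (s ℤ.+ (s ℤ.+ (s ℤ.+ s))) ℤ.- + 5 ℤ.* s)
    ≡⟨ cancel s ⟩
  0ℤ ∎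
  where
  open ≡-Reasoning
  K = triangularVectors 5 n
  first : Vec ℕ 5 → ℤ
  first v = + triangular (Vec.head v)
  s = ∑ K first
  cancel : ∀ s → + 8 ℤ.* (s ℤ.+ (s ℤ.+ (s ℤ.+ (s ℤ.+ s))) ℤ.- + 5 ℤ.* s) ≡ 0ℤ
  cancel = solve-∀
  rotate₅ rotate₅⁻¹ : Vec ℕ 5 → Vec ℕ 5
  rotate₅   (a ∷ b ∷ c ∷ d ∷ e ∷ []) = b ∷ c ∷ d ∷ e ∷ a ∷ []
  rotate₅⁻¹ (b ∷ c ∷ d ∷ e ∷ a ∷ []) = a ∷ b ∷ c ∷ d ∷ e ∷ []
  cyclic : ∀ a b c d e → a + (b + (c + (d + (e + 0)))) ≡ b + (c + (d + (e + (a + 0))))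
  cyclic = ℕ-Solver.solve-∀
  ∑-rotate₅ : ∀ w → ∑ K (w ∘ rotate₅) ≡ ∑ K w
  ∑-rotate₅ w = ∑-inv K K rotate₅ rotate₅⁻¹
    (λ { (a ∷ b ∷ c ∷ d ∷ e ∷ []) p →
      trans p (cyclic (triangular a) (triangular b) (triangular c) (triangular d) (triangular e)) })
    (λ { (b ∷ c ∷ d ∷ e ∷ a ∷ []) p →
      trans p (sym (cyclic (triangular a) (triangular b) (triangular c) (triangular d) (triangular e))) })
    (λ { (a ∷ b ∷ c ∷ d ∷ e ∷ []) _ → refl }) (λ { (b ∷ c ∷ d ∷ e ∷ a ∷ []) _ → refl }) (λ _ _ → refl)
  first₂ first₃ first₄ first₅ : Vec ℕ 5 → ℤ
  first₂ = first ∘ rotate₅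
  first₃ = first₂ ∘ rotate₅
  first₄ = first₃ ∘ rotate₅
  first₅ = first₄ ∘ rotate₅
  total : ∑ K (λ _ → + n) ≡ s ℤ.+ (s ℤ.+ (s ℤ.+ (s ℤ.+ s)))
  total = trans
    (∑-cong K {v = λ v → first v ℤ.+ (first₂ v ℤ.+ (first₃ v ℤ.+ (first₄ v ℤ.+ first₅ v)))}
      (λ { (a ∷ b ∷ c ∷ d ∷ e ∷ []) p → trans (cong +_ p)
         (cong (λ t → + (triangular a + (triangular b + (triangular c + (triangular d + t))))) (ℕₚ.+-identityʳ (triangular e))) }))
    (trans (∑-+ K first _) (cong (λ t → s ℤ.+ t)
    (trans (∑-+ K first₂ _) (cong₂ ℤ._+_ s₂
    (trans (∑-+ K first₃ _) (cong₂ ℤ._+_ s₃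
    (trans (∑-+ K first₄ _) (cong₂ ℤ._+_ s₄ (trans (∑-rotate₅ first₄) s₄)))))))))
    where
    s₂ = ∑-rotate₅ first
    s₃ = trans (∑-rotate₅ first₂) s₂
    s₄ = trans (∑-rotate₅ first₃) s₃

divisorSum : ℕ → ℤ
divisorSum m = ∑ (oddCofactors m) (λ (d , _) → + d)

5+8*-odd : ∀ n → Odd (5 + 8 * n)
5+8*-odd n = trans (cong parity (expand n)) (odd-1+2* (2 + 4 * n))
  where
  expand : ∀ n → 5 + 8 * n ≡ 1 + 2 * (2 + 4 * n)
  expand = ℕ-Solver.solve-∀

-- A root would be odd, and odd squares are 1 modulo 8.
5+8*-nonsquare : ∀ n k → k ℤ.* k ≢ + (5 + 8 * n)
5+8*-nonsquare n k eq = absurd (odd⇒1+2* ℤ.∣ k ∣ (odd-*⁻ˡ ℤ.∣ k ∣ ℤ.∣ k ∣ (trans (cong parity abs) (5+8*-odd n))))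
  where
  abs : ℤ.∣ k ∣ * ℤ.∣ k ∣ ≡ 5 + 8 * n
  abs = ℤₚ.+-injective (trans (sym (square-∣∣ k)) eq)
  split : ∀ n → 5 + 8 * n ≡ 1 + 4 * (1 + 2 * n)
  split = ℕ-Solver.solve-∀
  regroup : ∀ t → 1 + 8 * t ≡ 1 + 4 * (2 * t)
  regroup = ℕ-Solver.solve-∀
  absurd : ¬ (∃ λ z → ℤ.∣ k ∣ ≡ 1 + 2 * z)
  absurd (z , k≡) = odd⇒¬even {1 + 2 * n} (odd-1+2* n)
    (trans (cong parity (ℕₚ.*-cancelˡ-≡ (1 + 2 * n) (2 * triangular z) 4 (ℕₚ.suc-injective
      (trans (sym (split n)) (trans (sym abs) (trans (cong₂ _*_ k≡ k≡) (trans (odd-square z) (regroup (triangular z)))))))))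
      (even-2* (triangular z)))

5+8*-not-4* : ∀ n d e → + 4 ℤ.* (d ℤ.* e) ≢ + (5 + 8 * n)
5+8*-not-4* n d e eq = odd⇒¬even {5 + 8 * n} (5+8*-odd n)
  (trans (cong parity (trans (sym (cong ℤ.∣_∣ eq)) (trans (ℤₚ.abs-* (+ 4) (d ℤ.* e)) (quadruple ℤ.∣ d ℤ.* e ∣))))
    (even-2* (2 * ℤ.∣ d ℤ.* e ∣)))
  where
  quadruple : ∀ k → 4 * k ≡ 2 * (2 * k)
  quadruple = ℕ-Solver.solve-∀

-- A factorization d e = 2i + 1 and a z with i + T(z) = n make up the form (2z + 1, d, e). That
-- every form with x > 0 arises is a matter of congruences: m odd forces x odd, and then m ≡ 5, x² ≡
-- 1 modulo 8 force d e odd.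
σ-recursion : ∀ n → ((λ i → divisorSum (1 + 2 * i)) ∗ weighted n) n ≡ 0ℤ
σ-recursion n = trans
  (∑-conv (sumPairs n) (λ i → oddCofactors (1 + 2 * i)) (triangularVectors 1) K
    triple
    (λ { {i} {i′} (_ , _ , p) (_ , _ , q) → ℕₚ.*-cancelˡ-≡ i i′ 2 (ℕₚ.suc-injective (trans (sym p) q)) })
    (λ p q → trans p (sym q))
    (λ { {c = z ∷ []} → toForm z })
    (λ { {c = z ∷ []} {c′ = z′ ∷ []} → injective z z′ })
    (fromForm _)
    (λ { {b = d , e} {c = z ∷ []} _ _ _ → cong (λ s → + d ℤ.* s) (weights z) }))
  (∑-weight-positive m (5+8*-nonsquare n) (5+8*-not-4* n))
  where
  m = 5 + 8 * n
  triple : ℕ × ℕ → Vec ℕ 1 → Triple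
  triple (d , e) (z ∷ []) = + (1 + 2 * z) , + d , + e
  K = restrict (indefinites m) (λ (x , _) → 0ℤ ℤ.<? x)
  expand : ∀ i t → 1 + 8 * t + 4 * (1 + 2 * i) ≡ 5 + 8 * (i + t)
  expand = ℕ-Solver.solve-∀
  toForm : ∀ z {i j d e} → i + j ≡ n → OddCofactor (1 + 2 * i) (d , e) → j ≡ triangular z + 0 →
          Indefinite m (+ (1 + 2 * z) , + d , + e) × 0ℤ ℤ.< + (1 + 2 * z)
  toForm z {i} {_} {d} {e} refl (d>0 , oe , de) refl =
    (ℤ.+<+ d>0 , ℤ.+<+ (odd⇒>0 oe) ,
      trans (cong₂ ℤ._+_ (sym (ℤₚ.pos-* (1 + 2 * z) (1 + 2 * z)))
              (trans (cong (λ s → + 4 ℤ.* s) (sym (ℤₚ.pos-* d e))) (sym (ℤₚ.pos-* 4 (d * e)))))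
        (cong +_ (trans (cong₂ (λ s t → s + 4 * t) (odd-square z) de)
          (trans (expand i (triangular z)) (cong (λ t → 5 + 8 * (i + t)) (sym (ℕₚ.+-identityʳ (triangular z)))))))) ,
    ℤ.+<+ ℕ.z<s
  injective : ∀ z z′ {d e d′ e′} → (+ (1 + 2 * z) , + d , + e) ≡ (+ (1 + 2 * z′) , + d′ , + e′) →
              (d , e) ≡ (d′ , e′) × (z ∷ []) ≡ (z′ ∷ [])
  injective z z′ eq =
    cong₂ _,_ (ℤₚ.+-injective (cong (proj₁ ∘ proj₂) eq)) (ℤₚ.+-injective (cong (proj₂ ∘ proj₂) eq)) ,
    cong (_∷ []) (ℕₚ.*-cancelˡ-≡ z z′ 2 (ℕₚ.suc-injective (ℤₚ.+-injective (cong proj₁ eq))))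
  weights : ∀ z → + 8 ℤ.* (+ n ℤ.- + 5 ℤ.* + (triangular z + 0)) ≡
                  + m ℤ.- + 5 ℤ.* (+ (1 + 2 * z) ℤ.* + (1 + 2 * z))
  weights z = trans (cong (λ t → + 8 ℤ.* (+ n ℤ.- + 5 ℤ.* + t)) (ℕₚ.+-identityʳ (triangular z)))
    (trans (identity (+ n) (+ triangular z))
    (sym (cong₂ (λ s t → (+ 5 ℤ.+ s) ℤ.- + 5 ℤ.* t) (ℤₚ.pos-* 8 n)
      (trans (sym (ℤₚ.pos-* (1 + 2 * z) (1 + 2 * z)))
        (trans (cong +_ (odd-square z)) (cong (λ s → 1ℤ ℤ.+ s) (ℤₚ.pos-* 8 (triangular z))))))))
    where
    identity : ∀ n t → + 8 ℤ.* (n ℤ.- + 5 ℤ.* t) ≡ + 5 ℤ.+ + 8 ℤ.* n ℤ.- + 5 ℤ.* (1ℤ ℤ.+ + 8 ℤ.* t)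
    identity = solve-∀
  fromForm : ∀ t → Indefinite m t × 0ℤ ℤ.< proj₁ t →
    ∃₂ λ i j → ∃₂ λ (de : ℕ × ℕ) (z : Vec ℕ 1) → i + j ≡ n × OddCofactor (1 + 2 * i) de × j ≡ sumOfTriangulars z ×
      triple de z ≡ t
  fromForm (+ x , + d , + e) ((ℤ.+<+ d>0 , ℤ.+<+ e>0 , eq) , _) = result
    where
    nat : x * x + 4 * (d * e) ≡ m
    nat = indefinite-ℕ (+ x) d e eq
    odd-x : Odd x
    odd-x with odd? x
    ... | yes o = o
    -- For x = 2k the discriminant would be 4 (k² + d e), excluded through the factorization 1 · (k²
    -- + d e).
    ... | no ¬o with k , refl ← even⇒2* x (¬odd⇒even {x} ¬o) =
      contradiction (cong +_ (trans (sym (quadruple k (d * e))) nat)) λ eq′ →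
        5+8*-not-4* n 1ℤ (+ (k * k + d * e)) (trans (cong (λ s → + 4 ℤ.* s) (ℤₚ.*-identityˡ _))
          (trans (sym (ℤₚ.pos-* 4 (k * k + d * e))) eq′))
      where
      quadruple : ∀ k p → 2 * k * (2 * k) + 4 * p ≡ 4 * (k * k + p)
      quadruple = ℕ-Solver.solve-∀
    result : _
    result with z , refl ← odd⇒1+2* x odd-x = continue (odd⇒1+2* (d * e) odd-de)
      where
      lhs : ∀ t p → 1 + 8 * t + 4 * p ≡ 1 + 4 * (p + 2 * t)
      lhs = ℕ-Solver.solve-∀
      rhs : ∀ n → 5 + 8 * n ≡ 1 + 4 * (1 + 2 * n)
      rhs = ℕ-Solver.solve-∀
      reduced : d * e + 2 * triangular z ≡ 1 + 2 * n
      reduced = ℕₚ.*-cancelˡ-≡ _ _ 4 (ℕₚ.suc-injective (trans (sym (lhs (triangular z) (d * e)))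
        (trans (cong (_+ 4 * (d * e)) (sym (odd-square z))) (trans nat (rhs n)))))
      odd-de : Odd (d * e)
      odd-de with odd? (d * e)
      ... | yes o = o
      ... | no ¬o = contradiction
        (trans (cong parity (sym reduced)) (trans (ℙₚ.+-homo-+ (d * e) (2 * triangular z))
          (cong₂ ℙ._+_ (¬odd⇒even {d * e} ¬o) (even-2* (triangular z)))))
        (odd⇒¬even {1 + 2 * n} (odd-1+2* n))
      collect : ∀ i t → 1 + 2 * i + 2 * t ≡ 1 + 2 * (i + t)
      collect = ℕ-Solver.solve-∀
      continue : (∃ λ i → d * e ≡ 1 + 2 * i) → _
      continue (i , de) = i , triangular z + 0 , (d , e) , (z ∷ []) ,
        trans (cong (λ t → i + t) (ℕₚ.+-identityʳ (triangular z)))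
          (ℕₚ.*-cancelˡ-≡ _ _ 2 (ℕₚ.suc-injective (trans (sym (collect i (triangular z)))
            (trans (cong (_+ 2 * triangular z) (sym de)) reduced)))) ,
        (d>0 , odd-*⁻ʳ d e odd-de , de) , refl , refl

δ₄≡σ : ∀ n → δᶻ 4 n ≡ divisorSum (1 + 2 * n)
δ₄≡σ n = ℤₚ.i-j≡0⇒i≡j _ _ (recursion-unique (λ i → δᶻ 4 i ℤ.- s i) weighted
  (λ n → trans (∗-distribʳ-- (δᶻ 4) s (weighted n) n)
    (cong₂ ℤ._-_ (trans (∗-comm (δᶻ 4) (weighted n) n) (δ₄-recursion n)) (σ-recursion n)))
  leading n)
  where
  s : ℕ → ℤ
  s i = divisorSum (1 + 2 * i)
  leading : ∀ n → δᶻ 4 n ℤ.- s n ≡ 0ℤ ⊎ weighted n 0 ≢ 0ℤ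
  -- The leading coefficient `weighted n 0` is 8n. It vanishes at n = 0, where both sequences
  -- evaluate to 1 and are compared directly.
  leading zero    = inj₁ refl
  leading (suc n) = inj₂ λ ()

-- The character χ₋₄

mod-4-elim : (P : ℕ → Set) → P 0 → P 1 → P 2 → P 3 → (∀ n → P n → P (4 + n)) → ∀ n → P n
mod-4-elim P p₀ p₁ p₂ p₃ step 0 = p₀
mod-4-elim P p₀ p₁ p₂ p₃ step 1 = p₁
mod-4-elim P p₀ p₁ p₂ p₃ step 2 = p₂
mod-4-elim P p₀ p₁ p₂ p₃ step 3 = p₃
mod-4-elim P p₀ p₁ p₂ p₃ step (suc (suc (suc (suc n)))) = step n (mod-4-elim P p₀ p₁ p₂ p₃ step n)

-- Recursion in steps of 4, as for `χ₋₄`, makes the period definitional, so identities between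
-- residues hold by evaluation.
[4∣_] : ℕ → ℤ
[4∣ 0 ] = 1ℤ
[4∣ 1 ] = 0ℤ
[4∣ 2 ] = 0ℤ
[4∣ 3 ] = 0ℤ
[4∣ suc (suc (suc (suc n))) ] = [4∣ n ]

4*-periodic : (f : ℕ → ℤ) → (∀ n → f (4 + n) ≡ f n) → ∀ k n → f (4 * k + n) ≡ f n
4*-periodic f period zero    n = refl
4*-periodic f period (suc k) n = trans (cong f (step k n)) (trans (period (4 * k + n)) (4*-periodic f period k n))
  where
  step : ∀ k n → 4 * suc k + n ≡ 4 + (4 * k + n)
  step = ℕ-Solver.solve-∀

χ-4* : ∀ k n → χ₋₄ (4 * k + n) ≡ χ₋₄ n
χ-4* = 4*-periodic χ₋₄ (λ _ → refl)

[4∣]-4* : ∀ k n → [4∣ 4 * k + n ] ≡ [4∣ n ]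
[4∣]-4* = 4*-periodic [4∣_] (λ _ → refl)

χ-* : ∀ m n → χ₋₄ (m * n) ≡ χ₋₄ m ℤ.* χ₋₄ n
χ-* = mod-4-elim (λ m → ∀ n → χ₋₄ (m * n) ≡ χ₋₄ m ℤ.* χ₋₄ n)
  (λ _ → refl)
  (λ n → trans (cong χ₋₄ (ℕₚ.*-identityˡ n)) (sym (ℤₚ.*-identityˡ (χ₋₄ n))))
  (mod-4-elim _ refl refl refl refl (λ n p → trans (shift 2 n) p))
  (mod-4-elim _ refl refl refl refl (λ n p → trans (shift 3 n) p))
  (λ m p n → trans (trans (cong χ₋₄ (expand m n)) (χ-4* n (m * n))) (p n))
  where
  expand : ∀ m n → (4 + m) * n ≡ 4 * n + m * n
  expand = ℕ-Solver.solve-∀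
  expand′ : ∀ k n → k * (4 + n) ≡ 4 * k + k * n
  expand′ = ℕ-Solver.solve-∀
  shift : ∀ k n → χ₋₄ (k * (4 + n)) ≡ χ₋₄ (k * n)
  shift k n = trans (cong χ₋₄ (expand′ k n)) (χ-4* k (k * n))

χ-odd : ∀ n → Odd n → χ₋₄ n ≡ 1ℤ ⊎ χ₋₄ n ≡ ℤ.-1ℤ
χ-odd = mod-4-elim (λ n → Odd n → χ₋₄ n ≡ 1ℤ ⊎ χ₋₄ n ≡ ℤ.-1ℤ)
  (λ ()) (λ _ → inj₁ refl) (λ ()) (λ _ → inj₂ refl) (λ _ p → p)

χ≡1⇒1+4* : ∀ n → χ₋₄ n ≡ 1ℤ → ∃ λ k → n ≡ 1 + 4 * k
χ≡1⇒1+4* = mod-4-elim (λ n → χ₋₄ n ≡ 1ℤ → ∃ λ k → n ≡ 1 + 4 * k)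
  (λ ()) (λ _ → 0 , refl) (λ ()) (λ ())
  (λ n p χ≡1 → let k , n≡ = p χ≡1 in suc k , trans (cong (λ m → 4 + m) n≡) (step k))
  where
  step : ∀ k → 4 + (1 + 4 * k) ≡ 1 + 4 * suc k
  step = ℕ-Solver.solve-∀

[4∣2*]-odd : ∀ d → Odd d → [4∣ 2 * d ] ≡ 0ℤ
[4∣2*]-odd d o with k , refl ← odd⇒1+2* d o = trans (cong [4∣_] (expand k)) ([4∣]-4* k 2)
  where
  expand : ∀ k → 2 * (1 + 2 * k) ≡ 4 * k + 2
  expand = ℕ-Solver.solve-∀

[4∣2*]-even : ∀ d → Even d → [4∣ 2 * d ] ≡ 1ℤ
[4∣2*]-even d e with k , refl ← even⇒2* d e = trans (cong [4∣_] (expand k)) ([4∣]-4* k 0)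
  where
  expand : ∀ k → 2 * (2 * k) ≡ 4 * k + 0
  expand = ℕ-Solver.solve-∀

private
  shift-both : ∀ b k → (4 + b) + k + (4 + b) ≡ 4 * 2 + (b + k + b)
  shift-both = ℕ-Solver.solve-∀

-- With a = b + k the absolute difference disappears and both sides depend only on b and k modulo 4:
-- raising b by 4 raises b + k + b by 8. Sixteen evaluations remain.
χχ-shifted : ∀ b k → χ₋₄ (b + k) ℤ.* χ₋₄ b ≡ [4∣ k ] ℤ.- [4∣ b + k + b ]
χχ-shifted = mod-4-elim (λ b → ∀ k → χ₋₄ (b + k) ℤ.* χ₋₄ b ≡ [4∣ k ] ℤ.- [4∣ b + k + b ])
  (mod-4-elim _ refl refl refl refl (λ _ p → p))
  (mod-4-elim _ refl refl refl refl (λ _ p → p))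
  (mod-4-elim _ refl refl refl refl (λ _ p → p))
  (mod-4-elim _ refl refl refl refl (λ _ p → p))
  (λ b p k → trans (p k) (cong (λ s → [4∣ k ] ℤ.- s)
    (sym (trans (cong [4∣_] (shift-both b k)) ([4∣]-4* 2 (b + k + b))))))

-- For odd a = b + k and b, the numbers a - b and a + b are even and differ by 2b, which is 2 modulo
-- 4.
[4∣]-complement : ∀ b k → Odd b → Odd (b + k) → [4∣ k ] ℤ.+ [4∣ b + k + b ] ≡ 1ℤ
[4∣]-complement = mod-4-elim (λ b → ∀ k → Odd b → Odd (b + k) → [4∣ k ] ℤ.+ [4∣ b + k + b ] ≡ 1ℤ)
  (λ _ ())
  (mod-4-elim _ (λ _ _ → refl) (λ _ ()) (λ _ _ → refl) (λ _ ()) (λ _ p → p))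
  (λ _ ())
  (mod-4-elim _ (λ _ _ → refl) (λ _ ()) (λ _ _ → refl) (λ _ ()) (λ _ p → p))
  (λ b p k o o′ → trans (cong (λ s → [4∣ k ] ℤ.+ s)
    (trans (cong [4∣_] (shift-both b k)) ([4∣]-4* 2 (b + k + b)))) (p k o o′))

∣-∣-wlog : (Q : ℕ → ℕ → ℕ → Set) → (∀ {a b c} → Q a b c → Q b a c) → (∀ b k → Q (b + k) b k) →
           ∀ a b → Q a b ℕ.∣ a - b ∣
∣-∣-wlog Q Q-sym Q-shifted = wlog ℕₚ.≤-total
  (λ {a} {b} q → subst (Q b a) (ℕₚ.∣-∣-comm a b) (Q-sym q))
  (λ a b a≤b → subst₂ (λ b k → Q a b k) (ℕₚ.m+[n∸m]≡n a≤b) (sym (ℕₚ.m≤n⇒∣m-n∣≡n∸m a≤b)) (Q-sym (Q-shifted a (b ∸ a))))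

χχ-difference : ∀ a b → χ₋₄ a ℤ.* χ₋₄ b ≡ [4∣ ℕ.∣ a - b ∣ ] ℤ.- [4∣ a + b ]
χχ-difference = ∣-∣-wlog (λ a b c → χ₋₄ a ℤ.* χ₋₄ b ≡ [4∣ c ] ℤ.- [4∣ a + b ])
  (λ {a} {b} {c} p → trans (ℤₚ.*-comm (χ₋₄ b) (χ₋₄ a)) (trans p (cong (λ s → [4∣ c ] ℤ.- [4∣ s ]) (ℕₚ.+-comm a b))))
  χχ-shifted

square : ℕ → ℤ
square k = + k ℤ.* + k

product-difference : ∀ a b → ℤ.- (+ 4 ℤ.* (+ a ℤ.* + b)) ≡ square ℕ.∣ a - b ∣ ℤ.- square (a + b)
product-difference = ∣-∣-wlog (λ a b c → ℤ.- (+ 4 ℤ.* (+ a ℤ.* + b)) ≡ square c ℤ.- square (a + b))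
  (λ {a} {b} {c} p → trans (cong (λ s → ℤ.- (+ 4 ℤ.* s)) (ℤₚ.*-comm (+ b) (+ a)))
    (trans p (cong (λ s → square c ℤ.- square s) (ℕₚ.+-comm a b))))
  (λ b k → identity (+ b) (+ k))
  where
  identity : ∀ b k → ℤ.- (+ 4 ℤ.* ((b ℤ.+ k) ℤ.* b)) ≡ k ℤ.* k ℤ.- ((b ℤ.+ k) ℤ.+ b) ℤ.* ((b ℤ.+ k) ℤ.+ b)
  identity = solve-∀

-- Let p and q be the indicators of 4 dividing a - b and a + b. Then χ₋₄(a) χ₋₄(b) = p - q and 1 = p
-- + q, so (p - q)(a² + b²) - (p + q) 2ab completes the squares to p (a - b)² - q (a + b)².
χχ-square-difference : ∀ a b → Odd a → Odd b →
  χ₋₄ a ℤ.* χ₋₄ b ℤ.* (square a ℤ.+ square b) ℤ.- + 2 ℤ.* (+ a ℤ.* + b) ≡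
  [4∣ ℕ.∣ a - b ∣ ] ℤ.* square ℕ.∣ a - b ∣ ℤ.- [4∣ a + b ] ℤ.* square (a + b)
χχ-square-difference = ∣-∣-wlog
  (λ a b c → Odd a → Odd b → χ₋₄ a ℤ.* χ₋₄ b ℤ.* (square a ℤ.+ square b) ℤ.- + 2 ℤ.* (+ a ℤ.* + b) ≡
             [4∣ c ] ℤ.* square c ℤ.- [4∣ a + b ] ℤ.* square (a + b))
  (λ {a} {b} {c} p ob oa → trans (symmetric (χ₋₄ b) (χ₋₄ a) (+ b) (+ a))
    (trans (p oa ob) (cong (λ s → [4∣ c ] ℤ.* square c ℤ.- [4∣ s ] ℤ.* square s) (ℕₚ.+-comm a b))))
  shifted
  where
  symmetric : ∀ x y a b → x ℤ.* y ℤ.* (a ℤ.* a ℤ.+ b ℤ.* b) ℤ.- + 2 ℤ.* (a ℤ.* b) ≡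
                          y ℤ.* x ℤ.* (b ℤ.* b ℤ.+ a ℤ.* a) ℤ.- + 2 ℤ.* (b ℤ.* a)
  symmetric = solve-∀
  identity : ∀ p q b k →
    (p ℤ.- q) ℤ.* ((b ℤ.+ k) ℤ.* (b ℤ.+ k) ℤ.+ b ℤ.* b) ℤ.- (p ℤ.+ q) ℤ.* (+ 2 ℤ.* ((b ℤ.+ k) ℤ.* b)) ≡
    p ℤ.* (k ℤ.* k) ℤ.- q ℤ.* ((b ℤ.+ k ℤ.+ b) ℤ.* (b ℤ.+ k ℤ.+ b))
  identity = solve-∀
  shifted : ∀ b k → Odd (b + k) → Odd b →
    χ₋₄ (b + k) ℤ.* χ₋₄ b ℤ.* (square (b + k) ℤ.+ square b) ℤ.- + 2 ℤ.* (+ (b + k) ℤ.* + b) ≡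
    [4∣ k ] ℤ.* square k ℤ.- [4∣ b + k + b ] ℤ.* square (b + k + b)
  shifted b k oa ob = trans
    (cong₂ ℤ._-_ (cong (ℤ._* (square (b + k) ℤ.+ square b)) (χχ-shifted b k))
      (trans (sym (ℤₚ.*-identityˡ _)) (cong (ℤ._* (+ 2 ℤ.* (+ (b + k) ℤ.* + b))) (sym ([4∣]-complement b k ob oa)))))
    (identity [4∣ k ] [4∣ b + k + b ] (+ b) (+ k))

-- Convolutions of divisor sums

-- OddCofactor k is the set of factorizations of k when k is odd.
∑-quadruples : ∀ {R : Quadruple → Set} (K : Enumeration R) (p q : ℕ → ℕ) (w v : ℕ → ℤ) n →
  (∀ {i i′} → p i ≡ p i′ → i ≡ i′) → (∀ {j j′} → q j ≡ q j′ → j ≡ j′) →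
  (∀ {i j a x b y} → i + j ≡ n → OddCofactor (p i) (a , x) → OddCofactor (q j) (b , y) → R ((a , x) , (b , y))) →
  (∀ {a x b y} → R ((a , x) , (b , y)) → ∃₂ λ i j → i + j ≡ n × OddCofactor (p i) (a , x) × OddCofactor (q j) (b , y)) →
  ((λ i → ∑ (oddCofactors (p i)) (λ (d , _) → w d)) ∗ (λ j → ∑ (oddCofactors (q j)) (λ (d , _) → v d))) n
    ≡ ∑ K (λ ((a , _) , (b , _)) → w a ℤ.* v b)
∑-quadruples K p q w v n p-inj q-inj to from =
  ∑-conv (sumPairs n) (λ i → oddCofactors (p i)) (λ j → oddCofactors (q j)) K _,_
    (λ (_ , _ , e) (_ , _ , e′) → p-inj (trans (sym e) e′))
    (λ (_ , _ , e) (_ , _ , e′) → q-inj (trans (sym e) e′))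
    to (λ e → cong proj₁ e , cong proj₂ e)
    (λ r → let i , j , l , f , g = from r in i , j , _ , _ , l , f , g , refl)
    (λ _ _ _ → refl)

cubeSum : ℕ → ℤ
cubeSum m = ∑ (oddCofactors m) (λ (d , _) → + d ℤ.* (+ d ℤ.* + d))

-- In Liouville's identity for squares the left summand is (a - b)² - (a + b)² = -4ab and the right
-- one is d (0 - (2d)²) = -4d³.
∑-product : ∀ m → ∑ (oddQuadruples (2 * m)) (λ ((a , _) , (b , _)) → + a ℤ.* + b) ≡ cubeSum m
∑-product m = ℤₚ.*-cancelˡ-≡ -[1+ 3 ] _ _ (begin
  -[1+ 3 ] ℤ.* ∑ T (λ ((a , _) , (b , _)) → + a ℤ.* + b)
    ≡⟨ ∑-*ˡ T -[1+ 3 ] _ ⟨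
  ∑ T (λ ((a , _) , (b , _)) → -[1+ 3 ] ℤ.* (+ a ℤ.* + b))
    ≡⟨ ∑-cong T (λ ((a , _) , (b , _)) _ → trans (sym (ℤₚ.neg-distribˡ-* (+ 4) (+ a ℤ.* + b))) (product-difference a b)) ⟩
  ∑ T (λ ((a , _) , (b , _)) → square ℕ.∣ a - b ∣ ℤ.- square (a + b))
    ≡⟨ liouville square m ⟩
  ∑ D (λ (d , _) → + d ℤ.* (0ℤ ℤ.- square (2 * d)))
    ≡⟨ ∑-cong D (λ (d , _) _ → trans (cong (λ s → + d ℤ.* (0ℤ ℤ.- s ℤ.* s)) (ℤₚ.pos-* 2 d)) (identity (+ d))) ⟩
  ∑ D (λ (d , _) → -[1+ 3 ] ℤ.* (+ d ℤ.* (+ d ℤ.* + d)))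
    ≡⟨ ∑-*ˡ D -[1+ 3 ] _ ⟩
  -[1+ 3 ] ℤ.* cubeSum m ∎)
  where
  open ≡-Reasoning
  T = oddQuadruples (2 * m)
  D = oddCofactors m
  identity : ∀ d → d ℤ.* (0ℤ ℤ.- (+ 2 ℤ.* d) ℤ.* (+ 2 ℤ.* d)) ≡ -[1+ 3 ] ℤ.* (d ℤ.* (d ℤ.* d))
  identity = solve-∀

1+2*-injective : ∀ {i j} → 1 + 2 * i ≡ 1 + 2 * j → i ≡ j
1+2*-injective {i} {j} e = ℕₚ.*-cancelˡ-≡ i j 2 (ℕₚ.suc-injective e)

σ∗σ : ∀ n → ((λ i → divisorSum (1 + 2 * i)) ∗ (λ j → divisorSum (1 + 2 * j))) n ≡ cubeSum (1 + n)
σ∗σ n = trans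
  (∑-quadruples (oddQuadruples (2 * (1 + n))) (λ i → 1 + 2 * i) (λ j → 1 + 2 * j) +_ +_ n
    1+2*-injective 1+2*-injective
    (λ { {i} {j} {a} {x} {b} {y} refl (_ , ox , ax) (_ , oy , by) →
      (odd-*⁻ˡ a x (trans (cong parity ax) (odd-1+2* i)) , ox) ,
      (odd-*⁻ˡ b y (trans (cong parity by) (odd-1+2* j)) , oy) ,
      trans (cong₂ _+_ ax by) (collect i j) })
    from)
  (∑-product (1 + n))
  where
  collect : ∀ i j → 1 + 2 * i + (1 + 2 * j) ≡ 2 * (1 + (i + j))
  collect = ℕ-Solver.solve-∀
  from : ∀ {a x b y} → OddQuadruple (2 * (1 + n)) ((a , x) , (b , y)) →
         ∃₂ λ i j → i + j ≡ n × OddCofactor (1 + 2 * i) (a , x) × OddCofactor (1 + 2 * j) (b , y)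
  from {a} {x} {b} {y} ((oa , ox) , (ob , oy) , e)
    with i , ax ← odd⇒1+2* (a * x) (odd-* a x oa ox) | j , by ← odd⇒1+2* (b * y) (odd-* b y ob oy) =
    i , j , ℕₚ.suc-injective (ℕₚ.*-cancelˡ-≡ (1 + (i + j)) (1 + n) 2
      (trans (sym (collect i j)) (trans (sym (cong₂ _+_ ax by)) e))) ,
    (odd⇒>0 oa , ox , ax) , (odd⇒>0 ob , oy , by)

δ₈≡cubeSum : ∀ n → δᶻ 8 n ≡ cubeSum (1 + n)
δ₈≡cubeSum n = trans (sym (δ-∗ 4 4 n))
  (trans (∑-cong (sumPairs n) (λ (i , j) _ → cong₂ ℤ._*_ (δ₄≡σ i) (δ₄≡σ j))) (σ∗σ n))

χ² : ∀ n → Odd n → χ₋₄ n ℤ.* χ₋₄ n ≡ 1ℤ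
χ² n o with χ-odd n o
... | inj₁ p = cong₂ ℤ._*_ p p
... | inj₂ p = cong₂ ℤ._*_ p p

-- When ax ≢ 1 modulo 4, exchanging a and x changes the sign of χ₋₄ a.
∑-χ-restrict : ∀ N (g : ℕ → ℤ) →
  ∑ (oddQuadruples N) (λ ((a , _) , (b , _)) → χ₋₄ a ℤ.* g b) ≡
  ∑ (restrict (oddQuadruples N) (λ ((a , x) , _) → χ₋₄ (a * x) ℤ.≟ 1ℤ)) (λ ((a , _) , (b , _)) → χ₋₄ a ℤ.* g b)
∑-χ-restrict N g = trans (∑-split (oddQuadruples N) (λ ((a , x) , _) → χ₋₄ (a * x) ℤ.≟ 1ℤ) w)
  (trans (cong (λ s → ∑ (restrict (oddQuadruples N) (λ ((a , x) , _) → χ₋₄ (a * x) ℤ.≟ 1ℤ)) w ℤ.+ s) zeros)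
    (ℤₚ.+-identityʳ _))
  where
  w : Quadruple → ℤ
  w ((a , _) , (b , _)) = χ₋₄ a ℤ.* g b
  rest = restrict (oddQuadruples N) (λ ((a , x) , _) → ¬? (χ₋₄ (a * x) ℤ.≟ 1ℤ))
  flip : ∀ a x → Odd a → Odd x → χ₋₄ (a * x) ≢ 1ℤ → χ₋₄ a ≡ ℤ.- χ₋₄ x
  flip a x oa ox ≢1 with χ-odd (a * x) (odd-* a x oa ox)
  ... | inj₁ ≡1 = contradiction ≡1 ≢1
  ... | inj₂ ≡-1 = trans (sym (ℤₚ.*-identityʳ (χ₋₄ a))) (trans (cong (λ s → χ₋₄ a ℤ.* s) (sym (χ² x ox)))
    (trans (sym (ℤₚ.*-assoc (χ₋₄ a) (χ₋₄ x) (χ₋₄ x))) (trans (cong (ℤ._* χ₋₄ x) (trans (sym (χ-* a x)) ≡-1)) (ℤₚ.-1*i≡-i (χ₋₄ x)))))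
  exchangeFirst : Quadruple → Quadruple
  exchangeFirst ((a , x) , by) = (x , a) , by
  preserves : ∀ t → OddQuadruple N t × χ₋₄ (proj₁ (proj₁ t) * proj₂ (proj₁ t)) ≢ 1ℤ →
    let ((a , x) , _) = exchangeFirst t in OddQuadruple N (exchangeFirst t) × χ₋₄ (a * x) ≢ 1ℤ
  preserves ((a , x) , (b , y)) (((oa , ox) , o , e) , ≢1) =
    ((ox , oa) , o , trans (cong (_+ b * y) (ℕₚ.*-comm x a)) e) , λ ≡1 → ≢1 (trans (cong χ₋₄ (ℕₚ.*-comm a x)) ≡1)
  zeros : ∑ rest w ≡ 0ℤ
  zeros = i≡-i⇒i≡0 _ (trans
    (∑-inv rest rest exchangeFirst exchangeFirst {v = ℤ.-_ ∘ w} preserves preserves (λ _ _ → refl) (λ _ _ → refl)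
      (λ ((a , x) , (b , _)) (((oa , ox) , _) , ≢1) →
        trans (cong (ℤ._* g b) (flip a x oa ox ≢1)) (sym (ℤₚ.neg-distribˡ-* (χ₋₄ x) (g b)))))
    (∑-neg rest w))

characterSum : ℕ → ℤ
characterSum m = ∑ (oddCofactors m) (λ (d , _) → χ₋₄ d)

-- The convolution sees only the quadruples with a x ≡ 1 modulo 4, which forces b y ≡ c; by
-- `∑-χ-restrict` the other quadruples contribute nothing to the full sum.
characterSum-∗ : ∀ c → Odd c → c < 4 → (g : ℕ → ℤ) → ∀ n {N} → N ≡ 1 + c + 4 * n →
  ((λ i → characterSum (1 + 4 * i)) ∗ (λ j → ∑ (oddCofactors (c + 4 * j)) (λ (d , _) → g d))) n ≡
  ∑ (oddQuadruples N) (λ ((a , _) , (b , _)) → χ₋₄ a ℤ.* g b)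
characterSum-∗ c odd-c c<4 g n {N} N≡ = trans
  (∑-quadruples (restrict (oddQuadruples N) (λ ((a , x) , _) → χ₋₄ (a * x) ℤ.≟ 1ℤ))
    (λ i → 1 + 4 * i) (λ j → c + 4 * j) χ₋₄ g n
    (λ {i} {i′} e → ℕₚ.*-cancelˡ-≡ i i′ 4 (ℕₚ.suc-injective e))
    (λ {j} {j′} e → ℕₚ.*-cancelˡ-≡ j j′ 4 (ℕₚ.+-cancelˡ-≡ c (4 * j) (4 * j′) e))
    (λ {i} {j} → to {i} {j}) from)
  (sym (∑-χ-restrict N g))
  where
  even-4* : ∀ k → Even (4 * k)
  even-4* k = ℙₚ.*-homo-* 4 k
  to : ∀ {i j a x b y} → i + j ≡ n → OddCofactor (1 + 4 * i) (a , x) → OddCofactor (c + 4 * j) (b , y) →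
       OddQuadruple N ((a , x) , (b , y)) × χ₋₄ (a * x) ≡ 1ℤ
  to {i} {j} {a} {x} {b} {y} refl (_ , ox , ax) (_ , oy , by) =
    ((odd-*⁻ˡ a x (trans (cong parity ax) (odd+even 1 (4 * i) refl (even-4* i))) , ox) ,
     (odd-*⁻ˡ b y (trans (cong parity by) (odd+even c (4 * j) odd-c (even-4* j))) , oy) ,
     trans (cong₂ _+_ ax by) (trans (collect c i j) (sym N≡))) ,
    trans (cong χ₋₄ (trans ax (ℕₚ.+-comm 1 (4 * i)))) (χ-4* i 1)
    where
    collect : ∀ c i j → 1 + 4 * i + (c + 4 * j) ≡ 1 + c + 4 * (i + j)
    collect = ℕ-Solver.solve-∀
  from : ∀ {a x b y} → OddQuadruple N ((a , x) , (b , y)) × χ₋₄ (a * x) ≡ 1ℤ →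
         ∃₂ λ i j → i + j ≡ n × OddCofactor (1 + 4 * i) (a , x) × OddCofactor (c + 4 * j) (b , y)
  from {a} {x} {b} {y} (((oa , ox) , (ob , oy) , e) , ≡1) with i , ax ← χ≡1⇒1+4* (a * x) ≡1 =
    i , n ∸ i , ℕₚ.m+[n∸m]≡n i≤n , (odd⇒>0 oa , ox , ax) , (odd⇒>0 ob , oy , by)
    where
    total : 4 * i + b * y ≡ c + 4 * n
    total = ℕₚ.suc-injective (trans (cong (_+ b * y) (sym ax)) (trans e N≡))
    i≤n : i ≤ n
    -- If n < i, then 4 + 4n ≤ 4i ≤ c + 4n, against c < 4.
    i≤n = ℕₚ.≮⇒≥ λ n<i → ℕₚ.<⇒≱ (ℕₚ.+-monoˡ-< (4 * n) c<4)
      (ℕₚ.≤-trans (ℕₚ.≤-reflexive (sym (ℕₚ.*-suc 4 n)))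
        (ℕₚ.≤-trans (ℕₚ.*-monoʳ-≤ 4 n<i) (ℕₚ.m+n≤o⇒m≤o (4 * i) (ℕₚ.≤-reflexive total))))
    regroup : ∀ c i k → c + 4 * (i + k) ≡ 4 * i + (c + 4 * k)
    regroup = ℕ-Solver.solve-∀
    by : b * y ≡ c + 4 * (n ∸ i)
    by = ℕₚ.+-cancelˡ-≡ (4 * i) (b * y) (c + 4 * (n ∸ i)) (trans total
      (trans (cong (λ k → c + 4 * k) (sym (ℕₚ.m+[n∸m]≡n i≤n))) (regroup c i (n ∸ i))))

χ∗χ : ∀ n → ((λ i → characterSum (1 + 4 * i)) ∗ (λ j → characterSum (1 + 4 * j))) n ≡ divisorSum (1 + 2 * n)
χ∗χ n = begin
  ((λ i → characterSum (1 + 4 * i)) ∗ (λ j → characterSum (1 + 4 * j))) n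
    ≡⟨ characterSum-∗ 1 refl (s≤s (s≤s z≤n)) χ₋₄ n (double n) ⟩
  ∑ T (λ ((a , _) , (b , _)) → χ₋₄ a ℤ.* χ₋₄ b)
    ≡⟨ ∑-cong T (λ ((a , _) , (b , _)) _ → χχ-difference a b) ⟩
  ∑ T (λ ((a , _) , (b , _)) → [4∣ ℕ.∣ a - b ∣ ] ℤ.- [4∣ a + b ])
    ≡⟨ liouville [4∣_] (1 + 2 * n) ⟩
  ∑ D (λ (d , _) → + d ℤ.* (1ℤ ℤ.- [4∣ 2 * d ]))
    ≡⟨ ∑-cong D (λ (d , e) (_ , _ , de) → trans
         (cong (λ s → + d ℤ.* (1ℤ ℤ.- s)) ([4∣2*]-odd d (odd-*⁻ˡ d e (trans (cong parity de) (odd-1+2* n)))))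
         (ℤₚ.*-identityʳ (+ d))) ⟩
  divisorSum (1 + 2 * n) ∎
  where
  open ≡-Reasoning
  T = oddQuadruples (2 * (1 + 2 * n))
  D = oddCofactors (1 + 2 * n)
  double : ∀ n → 2 * (1 + 2 * n) ≡ 2 + 4 * n
  double = ℕ-Solver.solve-∀

δ₂≡characterSum : ∀ n → δᶻ 2 n ≡ characterSum (1 + 4 * n)
δ₂≡characterSum = ∗-square-injective (δᶻ 2) (λ i → characterSum (1 + 4 * i)) (λ ())
  (λ n → trans (δ-∗ 2 2 n) (trans (δ₄≡σ n) (sym (χ∗χ n))))

-- The odd cofactor cannot absorb the new factor 2, so doubling m doubles every d.
cubeSum-double : ∀ m → cubeSum (2 * m) ≡ + 8 ℤ.* cubeSum m
cubeSum-double m = sym (trans (sym (∑-*ˡ (oddCofactors m) (+ 8) _))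
  (∑-bij (oddCofactors m) (oddCofactors (2 * m)) (λ (d , e) → 2 * d , e)
    (λ (d , e) (d>0 , oe , de) → ℕₚ.*-mono-< {0} {2} {0} {d} ℕ.z<s d>0 , oe , trans (ℕₚ.*-assoc 2 d e) (cong (2 *_) de))
    (λ (d , e) (d′ , e′) _ _ eq → cong₂ _,_ (ℕₚ.*-cancelˡ-≡ d d′ 2 (cong proj₁ eq)) (cong proj₂ eq))
    surj
    (λ (d , _) _ → trans (identity (+ d)) (cong (λ s → s ℤ.* (s ℤ.* s)) (sym (ℤₚ.pos-* 2 d))))))
  where
  identity : ∀ d → + 8 ℤ.* (d ℤ.* (d ℤ.* d)) ≡ (+ 2 ℤ.* d) ℤ.* ((+ 2 ℤ.* d) ℤ.* (+ 2 ℤ.* d))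
  identity = solve-∀
  surj : ∀ t → OddCofactor (2 * m) t → ∃ λ (d , e) → OddCofactor m (d , e) × (2 * d , e) ≡ t
  surj (d , e) (d>0 , oe , de) with odd? d
  ... | yes od = contradiction (trans (cong parity (sym de)) (odd-* d e od oe)) (λ o → odd⇒¬even {2 * m} o (even-2* m))
  ... | no ¬od with k , refl ← even⇒2* d (¬odd⇒even {d} ¬od) =
    (k , e) , (ℕₚ.n≢0⇒n>0 (λ { refl → ℕₚ.<-irrefl refl d>0 }) , oe ,
      ℕₚ.*-cancelˡ-≡ (k * e) m 2 (trans (sym (ℕₚ.*-assoc 2 k e)) de)) , refl

characterSquareSum : ℕ → ℤ
characterSquareSum m = ∑ (oddCofactors m) (λ (d , _) → χ₋₄ d ℤ.* square d)

-- Symmetrized by `swap`, twice the sum s minus 2 Σ ab is the left side of Liouville's identity for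
-- F(k) = [4 ∣ k] k². As m is even and e odd, every d is even, so the right side is -4 Σ d³. Since Σ
-- ab = Σ d³, this gives 2s = -2 Σ d³.
∑-χχ-square : ∀ m → Even m →
  ∑ (oddQuadruples (2 * m)) (λ ((a , _) , (b , _)) → χ₋₄ a ℤ.* (χ₋₄ b ℤ.* square b)) ≡ ℤ.- cubeSum m
∑-χχ-square m even-m = ℤₚ.i-j≡0⇒i≡j _ _ (i+i≡0⇒i≡0 _ (begin
  (s ℤ.- ℤ.- cubeSum m) ℤ.+ (s ℤ.- ℤ.- cubeSum m)
    ≡⟨ regroup s (cubeSum m) ⟩
  (s ℤ.+ s ℤ.- + 2 ℤ.* cubeSum m) ℤ.+ + 4 ℤ.* cubeSum m
    ≡⟨ cong (ℤ._+ + 4 ℤ.* cubeSum m) main ⟩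
  -[1+ 3 ] ℤ.* cubeSum m ℤ.+ + 4 ℤ.* cubeSum m
    ≡⟨ cancel (cubeSum m) ⟩
  0ℤ ∎))
  where
  open ≡-Reasoning
  T = oddQuadruples (2 * m)
  D = oddCofactors m
  F : ℕ → ℤ
  F k = [4∣ k ] ℤ.* square k
  w : Quadruple → ℤ
  w ((a , _) , (b , _)) = χ₋₄ a ℤ.* (χ₋₄ b ℤ.* square b)
  s = ∑ T w
  swapped : s ≡ ∑ T (w ∘ swap)
  swapped = sym (∑-inv T T swap swap swap-odd swap-odd (λ _ _ → refl) (λ _ _ → refl) (λ _ _ → refl))
  regroup : ∀ s c → (s ℤ.- ℤ.- c) ℤ.+ (s ℤ.- ℤ.- c) ≡ (s ℤ.+ s ℤ.- + 2 ℤ.* c) ℤ.+ + 4 ℤ.* c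
  regroup = solve-∀
  cancel : ∀ c → -[1+ 3 ] ℤ.* c ℤ.+ + 4 ℤ.* c ≡ 0ℤ
  cancel = solve-∀
  expand : ∀ x y a b → x ℤ.* (y ℤ.* b) ℤ.+ y ℤ.* (x ℤ.* a) ≡ x ℤ.* y ℤ.* (a ℤ.+ b)
  expand = solve-∀
  identity : ∀ d → d ℤ.* (0ℤ ℤ.- 1ℤ ℤ.* ((+ 2 ℤ.* d) ℤ.* (+ 2 ℤ.* d))) ≡ -[1+ 3 ] ℤ.* (d ℤ.* (d ℤ.* d))
  identity = solve-∀
  even-d : ∀ d e → OddCofactor m (d , e) → Even d
  even-d d e (_ , oe , de) = ¬odd⇒even {d} λ od →
    odd⇒¬even {m} (trans (cong parity (sym de)) (odd-* d e od oe)) even-m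
  main : s ℤ.+ s ℤ.- + 2 ℤ.* cubeSum m ≡ -[1+ 3 ] ℤ.* cubeSum m
  main = begin
    s ℤ.+ s ℤ.- + 2 ℤ.* cubeSum m
      ≡⟨ cong₂ (λ t c → s ℤ.+ t ℤ.- + 2 ℤ.* c) swapped (sym (∑-product m)) ⟩
    s ℤ.+ ∑ T (w ∘ swap) ℤ.- + 2 ℤ.* ∑ T (λ ((a , _) , (b , _)) → + a ℤ.* + b)
      ≡⟨ cong₂ ℤ._-_ (sym (∑-+ T w (w ∘ swap))) (sym (∑-*ˡ T (+ 2) _)) ⟩
    ∑ T (λ t → w t ℤ.+ w (swap t)) ℤ.- ∑ T (λ ((a , _) , (b , _)) → + 2 ℤ.* (+ a ℤ.* + b))
      ≡⟨ ∑-- T _ _ ⟨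
    ∑ T (λ t@((a , _) , (b , _)) → w t ℤ.+ w (swap t) ℤ.- + 2 ℤ.* (+ a ℤ.* + b))
      ≡⟨ ∑-cong T (λ ((a , _) , (b , _)) ((oa , _) , (ob , _) , _) → trans
           (cong (ℤ._- + 2 ℤ.* (+ a ℤ.* + b)) (expand (χ₋₄ a) (χ₋₄ b) (square a) (square b)))
           (χχ-square-difference a b oa ob)) ⟩
    ∑ T (λ ((a , _) , (b , _)) → F ℕ.∣ a - b ∣ ℤ.- F (a + b))
      ≡⟨ liouville F m ⟩
    ∑ D (λ (d , _) → + d ℤ.* (0ℤ ℤ.- F (2 * d)))
      ≡⟨ ∑-cong D (λ (d , e) c → trans
           (cong₂ (λ k t → + d ℤ.* (0ℤ ℤ.- k ℤ.* (t ℤ.* t))) ([4∣2*]-even d (even-d d e c)) (ℤₚ.pos-* 2 d))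
           (identity (+ d))) ⟩
    ∑ D (λ (d , _) → -[1+ 3 ] ℤ.* (+ d ℤ.* (+ d ℤ.* + d)))
      ≡⟨ ∑-*ˡ D -[1+ 3 ] _ ⟩
    -[1+ 3 ] ℤ.* cubeSum m ∎

-- Here N = 4 + 4n is 2m with m = 2 (1 + n); the minus sign comes from `∑-χχ-square` and the 8 from
-- `cubeSum-double`.
χ∗χ-square : ∀ n → ((λ i → characterSum (1 + 4 * i)) ∗ (λ j → characterSquareSum (3 + 4 * j))) n ≡
                   -[1+ 7 ] ℤ.* cubeSum (1 + n)
χ∗χ-square n = trans (characterSum-∗ 3 refl (s≤s (s≤s (s≤s (s≤s z≤n)))) (λ d → χ₋₄ d ℤ.* square d) n (double n))
  (trans (∑-χχ-square (2 * (1 + n)) (even-2* (1 + n)))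
  (trans (cong ℤ.-_ (cubeSum-double (1 + n))) (ℤₚ.neg-distribˡ-* (+ 8) (cubeSum (1 + n)))))
  where
  double : ∀ n → 2 * (2 * (1 + n)) ≡ 4 + 4 * n
  double = ℕ-Solver.solve-∀

δ₆≡characterSquareSum : ∀ n → characterSquareSum (3 + 4 * n) ≡ -[1+ 7 ] ℤ.* δᶻ 6 n
δ₆≡characterSquareSum = ∗-cancelʳ (λ j → characterSquareSum (3 + 4 * j)) (λ j → -[1+ 7 ] ℤ.* δᶻ 6 j) (δᶻ 2) (λ ()) (λ n → begin
  ((λ j → characterSquareSum (3 + 4 * j)) ∗ δᶻ 2) n
    ≡⟨ ∗-comm (λ j → characterSquareSum (3 + 4 * j)) (δᶻ 2) n ⟩
  (δᶻ 2 ∗ (λ j → characterSquareSum (3 + 4 * j))) n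
    ≡⟨ ∑-cong (sumPairs n) (λ (i , j) _ → cong (ℤ._* characterSquareSum (3 + 4 * j)) (δ₂≡characterSum i)) ⟩
  ((λ i → characterSum (1 + 4 * i)) ∗ (λ j → characterSquareSum (3 + 4 * j))) n
    ≡⟨ χ∗χ-square n ⟩
  -[1+ 7 ] ℤ.* cubeSum (1 + n)
    ≡⟨ cong (λ s → -[1+ 7 ] ℤ.* s) (trans (sym (δ₈≡cubeSum n)) (sym (δ-∗ 6 2 n))) ⟩
  -[1+ 7 ] ℤ.* (δᶻ 6 ∗ δᶻ 2) n
    ≡⟨ ∑-*ˡ (sumPairs n) -[1+ 7 ] _ ⟨
  ∑ (sumPairs n) (λ (i , j) → -[1+ 7 ] ℤ.* (δᶻ 6 i ℤ.* δᶻ 2 j))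
    ≡⟨ ∑-cong (sumPairs n) (λ (i , j) _ → sym (ℤₚ.*-assoc -[1+ 7 ] (δᶻ 6 i) (δᶻ 2 j))) ⟩
  ((λ j → -[1+ 7 ] ℤ.* δᶻ 6 j) ∗ δᶻ 2) n ∎)
  where open ≡-Reasoning

-- Pairs of triangular numbers

2*≢1 : ∀ k → + 2 ℤ.* k ≢ 1ℤ
2*≢1 k eq = odd⇒¬even {1} refl (trans (cong (parity ∘ ℤ.∣_∣) (sym eq))
  (trans (cong parity (ℤₚ.abs-* (+ 2) k)) (even-2* ℤ.∣ k ∣)))

-- The two integers with a given triangular number are n and −1 − n.
triangularIndex : ℤ → ℕ
triangularIndex (+ n)    = n
triangularIndex -[1+ n ] = n

triangular-index : ∀ w → + triangular (triangularIndex w) ℤ.* + 2 ≡ w ℤ.* (w ℤ.+ 1ℤ)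
triangular-index (+ n) = trans (sym (ℤₚ.pos-* (triangular n) 2))
  (trans (cong +_ (triangular-double n)) (trans (ℤₚ.pos-* n (suc n)) (cong (λ s → + n ℤ.* s) (ℤₚ.+-comm 1ℤ (+ n)))))
triangular-index -[1+ n ] = trans (triangular-index (+ n)) (identity (+ n))
  where
  identity : ∀ n → n ℤ.* (n ℤ.+ 1ℤ) ≡ (ℤ.- (1ℤ ℤ.+ n)) ℤ.* (ℤ.- (1ℤ ℤ.+ n) ℤ.+ 1ℤ)
  identity = solve-∀

triangularIndex-fibre : ∀ v w → triangularIndex v ≡ triangularIndex w → v ≡ w ⊎ v ℤ.+ w ≡ ℤ.-1ℤ
triangularIndex-fibre (+ m)    (+ m)    refl = inj₁ refl
triangularIndex-fibre (+ m)    -[1+ m ] refl = inj₂ (identity (+ m))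
  where
  identity : ∀ m → m ℤ.+ ℤ.- (1ℤ ℤ.+ m) ≡ ℤ.-1ℤ
  identity = solve-∀
triangularIndex-fibre -[1+ m ] (+ m)    refl = inj₂ (identity (+ m))
  where
  identity : ∀ m → ℤ.- (1ℤ ℤ.+ m) ℤ.+ m ≡ ℤ.-1ℤ
  identity = solve-∀
triangularIndex-fibre -[1+ m ] -[1+ m ] refl = inj₁ refl

-- T(z + y) + T(z − y) = y² + 2 T(z), with the triangular numbers extended to ℤ.
split : ℤ → ℕ → ℕ × ℕ
split y z = triangularIndex (+ z ℤ.+ y) , triangularIndex (+ z ℤ.- y)

triangular-split : ∀ y z → let (p , q) = split y z in
  + (triangular p + triangular q) ≡ y ℤ.* y ℤ.+ + 2 ℤ.* + triangular z
triangular-split y z = ℤₚ.*-cancelʳ-≡ _ _ (+ 2) (begin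
  (+ triangular p ℤ.+ + triangular q) ℤ.* + 2
    ≡⟨ ℤₚ.*-distribʳ-+ (+ 2) (+ triangular p) (+ triangular q) ⟩
  + triangular p ℤ.* + 2 ℤ.+ + triangular q ℤ.* + 2
    ≡⟨ cong₂ ℤ._+_ (triangular-index (+ z ℤ.+ y)) (triangular-index (+ z ℤ.- y)) ⟩
  (+ z ℤ.+ y) ℤ.* (+ z ℤ.+ y ℤ.+ 1ℤ) ℤ.+ (+ z ℤ.- y) ℤ.* (+ z ℤ.- y ℤ.+ 1ℤ)
    ≡⟨ identity (+ z) y ⟩
  (y ℤ.* y) ℤ.* + 2 ℤ.+ (+ z ℤ.* (+ z ℤ.+ 1ℤ)) ℤ.* + 2
    ≡⟨ cong (λ t → (y ℤ.* y) ℤ.* + 2 ℤ.+ t ℤ.* + 2) (triangular-index (+ z)) ⟨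
  (y ℤ.* y) ℤ.* + 2 ℤ.+ (+ triangular z ℤ.* + 2) ℤ.* + 2
    ≡⟨ collect (y ℤ.* y) (+ triangular z) ⟩
  (y ℤ.* y ℤ.+ + 2 ℤ.* + triangular z) ℤ.* + 2 ∎)
  where
  open ≡-Reasoning
  p = proj₁ (split y z)
  q = proj₂ (split y z)
  identity : ∀ z y → (z ℤ.+ y) ℤ.* (z ℤ.+ y ℤ.+ 1ℤ) ℤ.+ (z ℤ.- y) ℤ.* (z ℤ.- y ℤ.+ 1ℤ) ≡
                     (y ℤ.* y) ℤ.* + 2 ℤ.+ (z ℤ.* (z ℤ.+ 1ℤ)) ℤ.* + 2
  identity = solve-∀
  collect : ∀ s t → s ℤ.* + 2 ℤ.+ (t ℤ.* + 2) ℤ.* + 2 ≡ (s ℤ.+ + 2 ℤ.* t) ℤ.* + 2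
  collect = solve-∀

-- Each coordinate determines its integer up to the reflection w ↦ -1 - w. A reflection in just one
-- coordinate would make an even integer equal to 1; reflections in both give z + z′ = -1,
-- impossible in ℕ.
split-injective : ∀ y z y′ z′ → split y z ≡ split y′ z′ → y ≡ y′ × z ≡ z′
split-injective y z y′ z′ eq
  with triangularIndex-fibre (+ z ℤ.+ y) (+ z′ ℤ.+ y′) (cong proj₁ eq)
     | triangularIndex-fibre (+ z ℤ.- y) (+ z′ ℤ.- y′) (cong proj₂ eq)
... | inj₁ a | inj₁ b = y≡y′ , z≡z′
  where
  sum-is-double : ∀ z y → (z ℤ.+ y) ℤ.+ (z ℤ.- y) ≡ + 2 ℤ.* z
  sum-is-double = solve-∀
  z≡z′ : z ≡ z′
  z≡z′ = ℤₚ.+-injective (ℤₚ.*-cancelˡ-≡ (+ 2) (+ z) (+ z′)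
    (trans (sym (sum-is-double (+ z) y)) (trans (cong₂ ℤ._+_ a b) (sum-is-double (+ z′) y′))))
  recover : ∀ z y → (z ℤ.+ y) ℤ.- z ≡ y
  recover = solve-∀
  y≡y′ : y ≡ y′
  y≡y′ = trans (sym (recover (+ z) y)) (trans (cong₂ (λ s t → s ℤ.- + t) a z≡z′) (recover (+ z′) y′))
... | inj₁ a | inj₂ b = contradiction
  (trans (identity (+ z) (+ z′) y y′) (cong₂ ℤ._-_ (ℤₚ.i≡j⇒i-j≡0 a) b)) (2*≢1 (y ℤ.- + z′))
  where
  identity : ∀ z z′ y y′ → + 2 ℤ.* (y ℤ.- z′) ≡ ((z ℤ.+ y) ℤ.- (z′ ℤ.+ y′)) ℤ.- ((z ℤ.- y) ℤ.+ (z′ ℤ.- y′))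
  identity = solve-∀
... | inj₂ a | inj₁ b = contradiction
  (trans (identity (+ z) (+ z′) y y′) (cong₂ ℤ._-_ (ℤₚ.i≡j⇒i-j≡0 b) a)) (2*≢1 (ℤ.- y ℤ.- + z′))
  where
  identity : ∀ z z′ y y′ → + 2 ℤ.* (ℤ.- y ℤ.- z′) ≡ ((z ℤ.- y) ℤ.- (z′ ℤ.- y′)) ℤ.- ((z ℤ.+ y) ℤ.+ (z′ ℤ.+ y′))
  identity = solve-∀
... | inj₂ a | inj₂ b = contradiction
  (ℤₚ.*-cancelˡ-≡ (+ 2) (+ z ℤ.+ + z′) ℤ.-1ℤ (trans (identity (+ z) (+ z′) y y′) (cong₂ ℤ._+_ a b))) λ ()
  where
  identity : ∀ z z′ y y′ → + 2 ℤ.* (z ℤ.+ z′) ≡ ((z ℤ.+ y) ℤ.+ (z′ ℤ.+ y′)) ℤ.+ ((z ℤ.- y) ℤ.+ (z′ ℤ.- y′))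
  identity = solve-∀

-- The number 2z must be a sum of integers with indices p and q. If p + q is odd, replacing the
-- smaller of the two by its reflection -1 - p or -1 - q makes the sum even and non-negative.
split-surjective : ∀ p q → ∃₂ λ y z → split y z ≡ (p , q)
split-surjective p q with odd? (p + q)
... | no even with z , p+q ← even⇒2* (p + q) (¬odd⇒even {p + q} even) = + p ℤ.- + z , z ,
  cong₂ (λ v w → triangularIndex v , triangularIndex w) (left (+ z) (+ p))
    (trans (right (+ z) (+ p)) (trans (cong (ℤ._- + p) (trans (sym (ℤₚ.pos-* 2 z)) (cong +_ (sym p+q)))) (cancel (+ p) (+ q))))
  where
  left : ∀ z p → z ℤ.+ (p ℤ.- z) ≡ p
  left = solve-∀
  right : ∀ z p → z ℤ.- (p ℤ.- z) ≡ + 2 ℤ.* z ℤ.- p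
  right = solve-∀
  cancel : ∀ p q → (p ℤ.+ q) ℤ.- p ≡ q
  cancel = solve-∀
... | yes odd with s , p+q ← odd⇒1+2* (p + q) odd with ℕₚ.≤-<-connex q s
...   | inj₁ q≤s = + p ℤ.- + z , z ,
  cong₂ (λ v w → triangularIndex v , triangularIndex w) (left (+ z) (+ p))
    (trans (cong (λ t → + z ℤ.- (t ℤ.- + z)) (trans (cong +_ p≡) (cong (λ t → 1ℤ ℤ.+ + q ℤ.+ t) (ℤₚ.pos-* 2 z)))) (right (+ z) (+ q)))
  where
  z = s ∸ q
  collect : ∀ q z → 1 + 2 * (q + z) ≡ 1 + q + 2 * z + q
  collect = ℕ-Solver.solve-∀
  p≡ : p ≡ 1 + q + 2 * z
  p≡ = ℕₚ.+-cancelʳ-≡ q p (1 + q + 2 * z)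
    (trans p+q (trans (cong (λ t → 1 + 2 * t) (sym (ℕₚ.m+[n∸m]≡n q≤s))) (collect q z)))
  left : ∀ z p → z ℤ.+ (p ℤ.- z) ≡ p
  left = solve-∀
  right : ∀ z q → z ℤ.- ((1ℤ ℤ.+ q ℤ.+ + 2 ℤ.* z) ℤ.- z) ≡ ℤ.- (1ℤ ℤ.+ q)
  right = solve-∀
...   | inj₂ s<q = + z ℤ.- + q , z ,
  cong₂ (λ v w → triangularIndex v , triangularIndex w)
    (trans (cong (λ t → + z ℤ.+ (+ z ℤ.- t)) (trans (cong +_ q≡) (cong (λ t → 1ℤ ℤ.+ + p ℤ.+ t) (ℤₚ.pos-* 2 z)))) (left (+ z) (+ p)))
    (right (+ z) (+ q))
  where
  p≤s : p ≤ s
  p≤s = ℕₚ.+-cancelʳ-≤ (suc s) p s (ℕₚ.≤-trans (ℕₚ.+-monoʳ-≤ p s<q) (ℕₚ.≤-reflexive (trans p+q (middle s))))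
    where
    middle : ∀ s → 1 + 2 * s ≡ s + suc s
    middle = ℕ-Solver.solve-∀
  z = s ∸ p
  collect : ∀ p z → 1 + 2 * (p + z) ≡ p + (1 + p + 2 * z)
  collect = ℕ-Solver.solve-∀
  q≡ : q ≡ 1 + p + 2 * z
  q≡ = ℕₚ.+-cancelˡ-≡ p q (1 + p + 2 * z)
    (trans p+q (trans (cong (λ t → 1 + 2 * t) (sym (ℕₚ.m+[n∸m]≡n p≤s))) (collect p z)))
  left : ∀ z p → z ℤ.+ (z ℤ.- (1ℤ ℤ.+ p ℤ.+ + 2 ℤ.* z)) ≡ ℤ.- (1ℤ ℤ.+ p)
  left = solve-∀
  right : ∀ z q → z ℤ.- (z ℤ.- q) ≡ q
  right = solve-∀

-- Unlike 2 * suc k, this reduces to two successors, so `splits` can prepend two entries without a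
-- cast.
double : ℕ → ℕ
double zero    = zero
double (suc k) = suc (suc (double k))

splits : ∀ {k} → Vec ℤ k → Vec ℕ k → Vec ℕ (double k)
splits []       []       = []
splits (y ∷ ys) (z ∷ zs) = proj₁ (split y z) ∷ proj₂ (split y z) ∷ splits ys zs

sumOfTriangulars-splits : ∀ {k} (ys : Vec ℤ k) zs →
  + sumOfTriangulars (splits ys zs) ≡ sumOfSquares ys ℤ.+ + 2 ℤ.* + sumOfTriangulars zs
sumOfTriangulars-splits []       []       = refl
sumOfTriangulars-splits (y ∷ ys) (z ∷ zs) = trans
  (cong +_ (sym (ℕₚ.+-assoc (triangular (proj₁ (split y z))) (triangular (proj₂ (split y z))) _)))
  (trans (cong₂ ℤ._+_ (triangular-split y z) (sumOfTriangulars-splits ys zs))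
    (interchange (y ℤ.* y) (+ triangular z) (sumOfSquares ys) (+ sumOfTriangulars zs)))
  where
  interchange : ∀ a b c d → (a ℤ.+ + 2 ℤ.* b) ℤ.+ (c ℤ.+ + 2 ℤ.* d) ≡ (a ℤ.+ c) ℤ.+ + 2 ℤ.* (b ℤ.+ d)
  interchange = solve-∀

splits-injective : ∀ {k} (ys : Vec ℤ k) zs ys′ zs′ → splits ys zs ≡ splits ys′ zs′ → ys ≡ ys′ × zs ≡ zs′
splits-injective []       []       []         []         _ = refl , refl
splits-injective (y ∷ ys) (z ∷ zs) (y′ ∷ ys′) (z′ ∷ zs′) eq
  with refl , refl ← split-injective y z y′ z′ (cong₂ _,_ (cong Vec.head eq) (cong (Vec.head ∘ Vec.tail) eq))
     | refl , refl ← splits-injective ys zs ys′ zs′ (cong (Vec.tail ∘ Vec.tail) eq) = refl , refl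

splits-surjective : ∀ k (v : Vec ℕ (double k)) → ∃₂ λ ys zs → splits ys zs ≡ v
splits-surjective zero    []          = [] , [] , refl
splits-surjective (suc k) (p ∷ q ∷ v)
  with y , z , refl ← split-surjective p q | ys , zs , refl ← splits-surjective k v = y ∷ ys , z ∷ zs , refl

convolutionPairs : ∀ n → Enumeration (λ ((a , b) : ℕ × ℕ) → a + 2 * b ≡ n)
convolutionPairs n = record
  { elements = pairs n
  ; unique   = pairs-unique n
  ; sound    = ⇒ ∈-pairs
  ; complete = ⇐ ∈-pairs
  }

∑-pairs-δ : ∀ k n → ∑ (convolutionPairs n) (λ (a , b) → rᶻ k a ℤ.* δᶻ k b) ≡ δᶻ (double k) n
∑-pairs-δ k n = trans
  (∑-cong (convolutionPairs n) (λ (a , b) _ →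
    cong₂ ℤ._*_ (sym (∑-1 (squareVectors k a))) (sym (∑-1 (triangularVectors k b)))))
  (trans (∑-conv (convolutionPairs n) (squareVectors k) (triangularVectors k) (triangularVectors (double k) n)
    {w = λ _ → 1ℤ} {v = λ _ → 1ℤ} {u = λ _ → 1ℤ} splits
    (λ p q → ℤₚ.+-injective (trans p (sym q))) (λ p q → trans p (sym q))
    (λ { {b = ys} {c = zs} refl p refl →
      ℤₚ.+-injective (trans (total (sumOfTriangulars zs) p) (sym (sumOfTriangulars-splits ys zs))) })
    (λ {b} {c} {b′} {c′} → splits-injective b c b′ c′)
    surj (λ _ _ _ → refl))
    (∑-1 (triangularVectors (double k) n)))
  where
  total : ∀ {a s} b → + a ≡ s → + (a + 2 * b) ≡ s ℤ.+ + 2 ℤ.* + b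
  total {a} b refl = cong (λ t → + a ℤ.+ t) (ℤₚ.pos-* 2 b)
  natural : ∀ {k} (ys : Vec ℤ k) → ∃ λ s → + s ≡ sumOfSquares ys
  natural []       = 0 , refl
  natural (y ∷ ys) = _ , cong₂ ℤ._+_ (sym (square-∣∣ y)) (proj₂ (natural ys))
  surj : ∀ {v} → n ≡ sumOfTriangulars v →
    ∃₂ λ a b → ∃₂ λ ys zs → a + 2 * b ≡ n × + a ≡ sumOfSquares ys × b ≡ sumOfTriangulars zs × splits {k} ys zs ≡ v
  surj {v} refl with ys , zs , refl ← splits-surjective k v =
    proj₁ (natural ys) , sumOfTriangulars zs , ys , zs ,
    ℤₚ.+-injective (trans (total (sumOfTriangulars zs) (proj₂ (natural ys))) (sym (sumOfTriangulars-splits ys zs))) ,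
    proj₂ (natural ys) , refl , refl

-- Sums of odd squares

oddInteger : Bool → ℕ → ℤ
oddInteger true  z = + (1 + 2 * z)
oddInteger false z = -[1+ 2 * z ]

∣oddInteger∣ : ∀ s z → ℤ.∣ oddInteger s z ∣ ≡ 1 + 2 * z
∣oddInteger∣ true  z = refl
∣oddInteger∣ false z = refl

oddInteger-square : ∀ s z → oddInteger s z ℤ.* oddInteger s z ≡ + (1 + 8 * triangular z)
oddInteger-square s z = trans (square-∣∣ (oddInteger s z))
  (cong +_ (trans (cong₂ _*_ (∣oddInteger∣ s z) (∣oddInteger∣ s z)) (odd-square z)))

oddInteger-injective : ∀ s z s′ z′ → oddInteger s z ≡ oddInteger s′ z′ → s ≡ s′ × z ≡ z′
oddInteger-injective true  z true  z′ eq = refl , ℕₚ.*-cancelˡ-≡ z z′ 2 (ℕₚ.suc-injective (ℤₚ.+-injective eq))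
oddInteger-injective false z false z′ eq = refl , ℕₚ.*-cancelˡ-≡ z z′ 2 (ℤₚ.-[1+-injective eq)

oddInteger-surjective : ∀ y → Odd ℤ.∣ y ∣ → ∃₂ λ s z → oddInteger s z ≡ y
oddInteger-surjective (+ n)    o with z , n≡ ← odd⇒1+2* n o = true , z , cong +_ (sym n≡)
oddInteger-surjective -[1+ n ] o with z , n≡ ← odd⇒1+2* (suc n) o = false , z , cong -[1+_] (sym (ℕₚ.suc-injective n≡))

oddIntegers : ∀ {k} → Vec Bool k → Vec ℕ k → Vec ℤ k
oddIntegers = Vec.zipWith oddInteger

sumOfSquares-oddIntegers : ∀ {k} (ss : Vec Bool k) zs →
  sumOfSquares (oddIntegers ss zs) ≡ + (8 * sumOfTriangulars zs + k)
sumOfSquares-oddIntegers []       []       = refl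
sumOfSquares-oddIntegers {suc k} (s ∷ ss) (z ∷ zs) = trans
  (cong₂ ℤ._+_ (oddInteger-square s z) (sumOfSquares-oddIntegers ss zs))
  (cong +_ (collect (triangular z) (sumOfTriangulars zs) k))
  where
  collect : ∀ t u k → (1 + 8 * t) + (8 * u + k) ≡ 8 * (t + u) + suc k
  collect = ℕ-Solver.solve-∀

oddIntegers-injective : ∀ {k} (ss : Vec Bool k) zs ss′ zs′ → oddIntegers ss zs ≡ oddIntegers ss′ zs′ → ss ≡ ss′ × zs ≡ zs′
oddIntegers-injective []       []       []         []         _ = refl , refl
oddIntegers-injective (s ∷ ss) (z ∷ zs) (s′ ∷ ss′) (z′ ∷ zs′) eq
  with refl , refl ← oddInteger-injective s z s′ z′ (cong Vec.head eq)
     | refl , refl ← oddIntegers-injective ss zs ss′ zs′ (cong Vec.tail eq) = refl , refl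

-- Here e is the number of even entries of y; squares are 0 or 1 modulo 4.
count-even : ∀ {k} (y : Vec ℤ k) → ∃₂ λ x e → e ≤ k × sumOfSquares y ℤ.+ + e ≡ + (4 * x + k) ×
  (e ≡ 0 → ∃₂ λ ss zs → oddIntegers ss zs ≡ y)
count-even [] = 0 , 0 , z≤n , refl , λ _ → [] , [] , refl
count-even {suc k} (y ∷ ys) with x , e , e≤k , eq , odds ← count-even ys | odd? ℤ.∣ y ∣
... | yes o with s , z , refl ← oddInteger-surjective y o =
  2 * triangular z + x , e , ℕₚ.m≤n⇒m≤1+n e≤k ,
  trans (cong (λ q → q ℤ.+ sumOfSquares ys ℤ.+ + e) (oddInteger-square s z))
    (trans (ℤₚ.+-assoc (+ (1 + 8 * triangular z)) (sumOfSquares ys) (+ e))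
      (trans (cong (λ q → + (1 + 8 * triangular z) ℤ.+ q) eq) (cong +_ (collect (triangular z) x k)))) ,
  λ e≡0 → let ss , zs , eq = odds e≡0 in s ∷ ss , z ∷ zs , cong (oddInteger s z ∷_) eq
  where
  collect : ∀ t x k → (1 + 8 * t) + (4 * x + k) ≡ 4 * (2 * t + x) + suc k
  collect = ℕ-Solver.solve-∀
... | no ¬o with h , ∣y∣≡ ← even⇒2* ℤ.∣ y ∣ (¬odd⇒even {ℤ.∣ y ∣} ¬o) =
  h * h + x , suc e , s≤s e≤k ,
  trans (cong (λ q → q ℤ.+ sumOfSquares ys ℤ.+ + suc e) (trans (square-∣∣ y) (cong (λ q → + (q * q)) ∣y∣≡)))
    (trans (regroup (+ (2 * h * (2 * h))) (sumOfSquares ys) (+ e))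
      (trans (cong (λ q → (+ (2 * h * (2 * h)) ℤ.+ 1ℤ) ℤ.+ q) eq) (cong +_ (collect h x k)))) ,
  λ ()
  where
  regroup : ∀ a s e → a ℤ.+ s ℤ.+ (1ℤ ℤ.+ e) ≡ (a ℤ.+ 1ℤ) ℤ.+ (s ℤ.+ e)
  regroup = solve-∀
  collect : ∀ h x k → (2 * h * (2 * h) + 1) + (4 * x + k) ≡ 4 * (h * h + x) + suc k
  collect = ℕ-Solver.solve-∀

-- The number e of even entries satisfies 8b + e = 4x, so 4 divides e, and e ≤ k < 4 leaves only e =
-- 0. For k = 4 this fails: 4 = 2² + 0² + 0² + 0².
oddIntegers-surjective : ∀ {k} → k < 4 → ∀ b (y : Vec ℤ k) → + (8 * b + k) ≡ sumOfSquares y →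
  ∃₂ λ ss zs → oddIntegers ss zs ≡ y
oddIntegers-surjective {k} k<4 b y eq with count-even y
... | x , zero  , _   , _    , odds = odds refl
... | x , suc e , e≤k , even , _    = contradiction
  (∣⇒≤ (∣m+n∣m⇒∣n (divides x (trans total (ℕₚ.*-comm 4 x))) (divides (b * 2) (octuple b))))
  (ℕₚ.<⇒≱ (ℕₚ.≤-<-trans e≤k k<4))
  where
  octuple : ∀ b → 8 * b ≡ b * 2 * 4
  octuple = ℕ-Solver.solve-∀
  regroup : ∀ a k e → a + e + k ≡ a + k + e
  regroup = ℕ-Solver.solve-∀
  total : 8 * b + suc e ≡ 4 * x
  total = ℕₚ.+-cancelʳ-≡ k (8 * b + suc e) (4 * x)
    (trans (regroup (8 * b) k (suc e)) (ℤₚ.+-injective (trans (cong (ℤ._+ + suc e) eq) even)))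

signVectors : ∀ k → Enumeration (λ (_ : Vec Bool k) → ⊤)
signVectors k = record
  { elements = vectors signs k
  ; unique   = vectors-unique (((λ ()) All.∷ All.[]) ∷ All.[] ∷ []) k
  ; sound    = λ _ → tt
  ; complete = λ {ss} _ → ∈-vectors (all ss)
  }
  where
  signs = true ∷ false ∷ []
  all : ∀ {k} (ss : Vec Bool k) → VAll (_∈ signs) ss
  all []           = []
  all (true  ∷ ss) = here refl ∷ all ss
  all (false ∷ ss) = there (here refl) ∷ all ss

-- Each solution is a choice of signs and of z with entries ±(2z + 1). The sum over signs is 2ᵏ;
-- left in this form, it evaluates to 4 and 8 by `refl` for k = 2 and k = 3.
r-δ : ∀ {k} → k < 4 → ∀ b → rᶻ k (8 * b + k) ≡ ∑ (signVectors k) (λ _ → 1ℤ) ℤ.* δᶻ k b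
r-δ {k} k<4 b = begin
  rᶻ k (8 * b + k)
    ≡⟨ ∑-1 Y ⟨
  ∑ Y (λ _ → 1ℤ)
    ≡⟨ ∑-bij SZ Y (λ (ss , zs) → oddIntegers ss zs)
         (λ (ss , zs) (_ , b≡) → trans (cong (λ t → + (8 * t + k)) b≡) (sym (sumOfSquares-oddIntegers ss zs)))
         (λ (ss , zs) (ss′ , zs′) _ _ eq → let p , q = oddIntegers-injective ss zs ss′ zs′ eq in cong₂ _,_ p q)
         surj (λ _ _ → refl) ⟨
  ∑ SZ (λ _ → 1ℤ)
    ≡⟨ ∑-bind (signVectors k) (λ _ → Z) (λ _ → 1ℤ) ⟩
  ∑ (signVectors k) (λ _ → ∑ Z (λ _ → 1ℤ))
    ≡⟨ ∑-cong (signVectors k) (λ _ _ → trans (∑-1 Z) (sym (ℤₚ.*-identityˡ (δᶻ k b)))) ⟩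
  ∑ (signVectors k) (λ _ → 1ℤ ℤ.* δᶻ k b)
    ≡⟨ ∑-*ʳ (signVectors k) (δᶻ k b) (λ _ → 1ℤ) ⟩
  ∑ (signVectors k) (λ _ → 1ℤ) ℤ.* δᶻ k b ∎
  where
  open ≡-Reasoning
  Y = squareVectors k (8 * b + k)
  Z = triangularVectors k b
  SZ = bind (signVectors k) (λ _ → Z)
  surj : ∀ y → + (8 * b + k) ≡ sumOfSquares y →
    ∃ λ (p : Vec Bool k × Vec ℕ k) → (⊤ × b ≡ sumOfTriangulars (proj₂ p)) × oddIntegers (proj₁ p) (proj₂ p) ≡ y
  surj y eq with ss , zs , refl ← oddIntegers-surjective k<4 b y eq = (ss , zs) , (tt ,
    ℕₚ.*-cancelˡ-≡ b _ 8 (ℕₚ.+-cancelʳ-≡ k (8 * b) (8 * sumOfTriangulars zs)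
      (ℤₚ.+-injective (trans eq (sumOfSquares-oddIntegers ss zs))))) , refl

-- Divisor functions as sums over factorizations

quotient-* : ∀ d e → 0 < d → quotient (d * e) d ≡ e
quotient-* d@(suc _) e _ = trans (cong (λ m → m ℕ./ d) (ℕₚ.*-comm d e)) (m*n/n≡m e d)

¬2∣⇒odd : ∀ n → ¬ 2 ∣ n → Odd n
¬2∣⇒odd n ¬2∣n with odd? n
... | yes o = o
... | no ¬o with k , n≡ ← even⇒2* n (¬odd⇒even {n} ¬o) = contradiction (divides k (trans n≡ (ℕₚ.*-comm 2 k))) ¬2∣n

odd⇒¬2∣ : ∀ {n} → Odd n → ¬ 2 ∣ n
odd⇒¬2∣ {n} o (divides k n≡) = odd⇒¬even {n} o (trans (cong parity (trans n≡ (ℕₚ.*-comm k 2))) (even-2* k))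

module _ (m : ℕ) .{{_ : ℕ.NonZero m}} where

  divisorEnumeration : Enumeration (_∣ m)
  divisorEnumeration = record
    { elements = divisors m
    ; unique   = divisors-unique m
    ; sound    = ⇒ ∈-divisors
    ; complete = ⇐ ∈-divisors
    }

  oddQuotient? : Decidable (λ d → ¬ 2 ∣ quotient m d)
  oddQuotient? d = ¬? (2 ∣? quotient m d)

  private
    positive : ∀ {d} q → m ≡ q * d → 0 < d
    positive q eq = ℕₚ.n≢0⇒n>0 λ { refl → ℕ.≢-nonZero⁻¹ m (trans eq (ℕₚ.*-zeroʳ q)) }

    quotient-cofactor : ∀ {d e} → 0 < d → d * e ≡ m → quotient m d ≡ e
    quotient-cofactor {d} {e} d>0 de = trans (cong (λ m → quotient m d) (sym de)) (quotient-* d e d>0)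

  ∑-oddQuotients : (w : ℕ → ℤ) →
    ∑ (restrict divisorEnumeration oddQuotient?) w ≡ ∑ (oddCofactors m) (λ (d , _) → w d)
  ∑-oddQuotients w = sym (∑-bij (oddCofactors m) (restrict divisorEnumeration oddQuotient?) proj₁
    (λ (d , e) (d>0 , oe , de) →
      divides e (trans (sym de) (ℕₚ.*-comm d e)) ,
      λ 2∣ → odd⇒¬2∣ {e} oe (subst (2 ∣_) (quotient-cofactor d>0 de) 2∣))
    (λ { (d , e) (_ , e′) (d>0 , _ , de) (_ , _ , de′) refl →
      cong (d ,_) (trans (sym (quotient-cofactor d>0 de)) (quotient-cofactor d>0 de′)) })
    surj (λ _ _ → refl))
    where
    surj : ∀ d → d ∣ m × ¬ 2 ∣ quotient m d → ∃ λ de → OddCofactor m de × proj₁ de ≡ d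
    surj d (divides q m≡ , ¬2∣) =
      (d , q) , (positive q m≡ , ¬2∣⇒odd q (subst (λ e → ¬ 2 ∣ e) (quotient-cofactor (positive q m≡) qd) ¬2∣) , qd) , refl
      where
      qd : d * q ≡ m
      qd = trans (ℕₚ.*-comm d q) (sym m≡)

  ∑-divisors-odd : Odd m → (w : ℕ → ℤ) → ∑ divisorEnumeration w ≡ ∑ (oddCofactors m) (λ (d , _) → w d)
  ∑-divisors-odd odd-m w = trans
    (∑-cong-pred divisorEnumeration (restrict divisorEnumeration oddQuotient?)
      (λ { d∣m@(divides q m≡) → d∣m , odd-quotient q m≡ }) proj₁)
    (∑-oddQuotients w)
    where
    odd-quotient : ∀ {d} q → m ≡ q * d → ¬ 2 ∣ quotient m d
    odd-quotient {d} q m≡ rewrite quotient-cofactor {d} {q} (positive q m≡) (trans (ℕₚ.*-comm d q) (sym m≡)) =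
      odd⇒¬2∣ {q} (odd-*⁻ˡ q d (trans (cong parity (sym m≡)) odd-m))

+-sum : (f : A → ℕ) (xs : List A) → + sum (map f xs) ≡ sumℤ (map (λ x → + f x) xs)
+-sum f []       = refl
+-sum f (x ∷ xs) = cong (λ s → + f x ℤ.+ s) (+-sum f xs)

+-sum-id : ∀ xs → + sum xs ≡ sumℤ (map (λ x → + x) xs)
+-sum-id []       = refl
+-sum-id (x ∷ xs) = cong (λ s → + x ℤ.+ s) (+-sum-id xs)

σ-odd : ∀ b → + σ (2 * b + 1) ≡ δᶻ 4 b
σ-odd b rewrite ℕₚ.+-comm (2 * b) 1 = trans (+-sum-id (divisors (1 + 2 * b)))
  (trans (∑-divisors-odd (1 + 2 * b) (odd-1+2* b) (λ d → + d)) (sym (δ₄≡σ b)))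

σ₃#-δ₈ : ∀ b → + σ₃# (b + 1) ≡ δᶻ 8 b
σ₃#-δ₈ b rewrite ℕₚ.+-comm b 1 = trans (+-sum (ℕ._^ 3) (filter (oddQuotient? (1 + b)) (divisors (1 + b))))
  (trans (∑-oddQuotients (1 + b) (λ d → + (d ℕ.^ 3)))
  (trans (∑-cong (oddCofactors (1 + b)) (λ (d , _) _ → cube d)) (sym (δ₈≡cubeSum b))))
  where
  cube : ∀ d → + (d ℕ.^ 3) ≡ + d ℤ.* (+ d ℤ.* + d)
  cube d = trans (cong (λ e → + (d * (d * e))) (ℕₚ.*-identityʳ d))
    (trans (ℤₚ.pos-* d (d * d)) (cong (λ s → + d ℤ.* s) (ℤₚ.pos-* d d)))

σ₂-χ : ∀ b → σ[ 2 ⨾ 𝟏 , χ₋₄ ] (4 * b + 3) ≡ -[1+ 7 ] ℤ.* δᶻ 6 b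
σ₂-χ b rewrite ℕₚ.+-comm (4 * b) 3 = trans
  (∑-cong (divisorEnumeration (3 + 4 * b)) (λ d _ → cong₂ ℤ._*_ (ℤₚ.*-identityʳ (χ₋₄ d))
    (trans (cong (λ e → + (d * e)) (ℕₚ.*-identityʳ d)) (ℤₚ.pos-* d d))))
  (trans (∑-divisors-odd (3 + 4 * b) (odd+even 3 (4 * b) refl (ℙₚ.*-homo-* 4 b)) (λ d → χ₋₄ d ℤ.* square d))
    (δ₆≡characterSquareSum b))

-- Assembling the five identities

-- For a variable i the normalized fraction `i / 1` does not compute, so the equation is checked
-- between unnormalised fractions, where it is the cross-multiplied hypothesis.
scale : ∀ (c : ℚ) i s → ℚ.↥ c ℤ.* s ≡ i ℤ.* ℚ.↧ c → i / 1 ≡ c ℚ.* (s / 1)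
scale c@(ℚ.mkℚ _ _ _) i s eq = ℚₚ.toℚᵘ-injective (ℚᵘₚ.≃-trans (ℚₚ.toℚᵘ-fromℚᵘ (ℚᵘ.mkℚᵘ i 0))
  (ℚᵘₚ.≃-trans unnormalised (ℚᵘₚ.≃-sym (ℚᵘₚ.≃-trans (ℚₚ.toℚᵘ-homo-* c (s / 1))
    (ℚᵘₚ.*-cong (ℚᵘₚ.≃-refl {ℚ.toℚᵘ c}) (ℚₚ.toℚᵘ-fromℚᵘ (ℚᵘ.mkℚᵘ s 0)))))))
  where
  unnormalised : ℚᵘ.mkℚᵘ i 0 ℚᵘ.≃ ℚ.toℚᵘ c ℚᵘ.* ℚᵘ.mkℚᵘ s 0
  unnormalised = ℚᵘ.*≡* (trans (cong (λ d → i ℤ.* + d) (ℕₚ.*-identityʳ (suc (ℚ.denominator-1 c))))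
    (trans (sym eq) (sym (ℤₚ.*-identityʳ (ℚ.↥ c ℤ.* s)))))

-- In all five identities the second factor is a constant multiple of δₖ(b); the constants are 4, 8,
-- 1, -8 and 1.
∑-pairs-scaled : ∀ k n c (f : ℕ → ℤ) → (∀ b → f b ≡ c ℤ.* δᶻ k b) →
  sumℤ (map (λ (a , b) → rᶻ k a ℤ.* f b) (pairs n)) ≡ c ℤ.* δᶻ (double k) n
∑-pairs-scaled k n c f eq = trans
  (∑-cong (convolutionPairs n) (λ (a , b) _ → trans (cong (λ s → rᶻ k a ℤ.* s) (eq b)) (swapˡ (rᶻ k a) c (δᶻ k b))))
  (trans (∑-*ˡ (convolutionPairs n) c (λ (a , b) → rᶻ k a ℤ.* δᶻ k b)) (cong (λ s → c ℤ.* s) (∑-pairs-δ k n)))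
  where
  swapˡ : ∀ x c y → x ℤ.* (c ℤ.* y) ≡ c ℤ.* (x ℤ.* y)
  swapˡ = solve-∀

sum-pairs-scaled : ∀ k n c (f : ℕ → ℕ) → (∀ b → + f b ≡ c ℤ.* δᶻ k b) →
  + sum (map (λ (a , b) → r k a * f b) (pairs n)) ≡ c ℤ.* δᶻ (double k) n
sum-pairs-scaled k n c f eq = trans (+-sum (λ (a , b) → r k a * f b) (pairs n))
  (trans (∑-cong (convolutionPairs n) (λ (a , b) _ → ℤₚ.pos-* (r k a) (f b)))
    (∑-pairs-scaled k n c (λ b → + f b) eq))

-- The dimension j is kept apart from double k: converting δ (double 6) n into δ 12 n unfolds δ.
sum-pairs : ∀ k {j} → double k ≡ j → ∀ n (f : ℕ → ℕ) → (∀ b → + f b ≡ δᶻ k b) →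
  δ j n ≡ sum (map (λ (a , b) → r k a * f b) (pairs n))
sum-pairs k refl n f eq = ℤₚ.+-injective (sym (trans
  (sum-pairs-scaled k n 1ℤ f (λ b → trans (eq b) (sym (ℤₚ.*-identityˡ (δᶻ k b)))))
  (ℤₚ.*-identityˡ (δᶻ (double k) n))))

r-pairs : ∀ k {j} → double k ≡ j → k < 4 → ∀ c d n → ∑ (signVectors k) (λ _ → 1ℤ) ≡ + d → ℚ.↥ c ≡ 1ℤ → ℚ.↧ c ≡ + d →
  (+ δ j n) / 1 ≡ c ℚ.* ((+ sum (map (λ (a , b) → r k a * r k (8 * b + k)) (pairs n))) / 1)
r-pairs k refl k<4 c d n 2ᵏ≡d ↥c ↧c = scale c (δᶻ (double k) n) s (begin
  ℚ.↥ c ℤ.* s                 ≡⟨ cong (ℤ._* s) ↥c ⟩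
  1ℤ ℤ.* s                    ≡⟨ ℤₚ.*-identityˡ s ⟩
  s                           ≡⟨ sum-pairs-scaled k n (+ d) (λ b → r k (8 * b + k))
                                   (λ b → trans (r-δ k<4 b) (cong (ℤ._* δᶻ k b) 2ᵏ≡d)) ⟩
  + d ℤ.* δᶻ (double k) n     ≡⟨ ℤₚ.*-comm (+ d) (δᶻ (double k) n) ⟩
  δᶻ (double k) n ℤ.* + d     ≡⟨ cong (λ e → δᶻ (double k) n ℤ.* e) ↧c ⟨
  δᶻ (double k) n ℤ.* ℚ.↧ c   ∎)
  where
  open ≡-Reasoning
  s = + sum (map (λ (a , b) → r k a * r k (8 * b + k)) (pairs n))

negative-pairs : ∀ k {j} → double k ≡ j → ∀ n (f : ℕ → ℤ) → (∀ b → f b ≡ -[1+ 7 ] ℤ.* δᶻ k b) →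
  (+ δ j n) / 1 ≡ (ℚ.- ((+ 1) / 8)) ℚ.* (sumℤ (map (λ (a , b) → (+ r k a) ℤ.* f b) (pairs n)) / 1)
negative-pairs k refl n f eq = scale (ℚ.- ((+ 1) / 8)) (δᶻ (double k) n) _
  -- The fraction -1/8 has numerator -1 and denominator 8, which together undo the factor -8.
  (trans (cong (λ s → ℤ.-1ℤ ℤ.* s) (∑-pairs-scaled k n -[1+ 7 ] f eq)) (identity (δᶻ (double k) n)))
  where
  identity : ∀ i → ℤ.-1ℤ ℤ.* (-[1+ 7 ] ℤ.* i) ≡ i ℤ.* + 8
  identity = solve-∀

corollary1p8 : ∀ (n : ℕ) →
    ((+ δ 4 n) / 1 ≡
    ((+ 1) / 4) ℚ.* ((+ sum (map (λ (a , b) → r 2 a * r 2 (8 * b + 2)) (pairs n))) / 1))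
    × ((+ δ 6 n) / 1 ≡
    ((+ 1) / 8) ℚ.* ((+ sum (map (λ (a , b) → r 3 a * r 3 (8 * b + 3)) (pairs n))) / 1))
    × (δ 8 n ≡
    sum (map (λ (a , b) → r 4 a * σ (2 * b + 1)) (pairs n)))
    × ((+ δ 12 n) / 1 ≡
    (ℚ.- ((+ 1) / 8)) ℚ.* (sumℤ (map (λ (a , b) → (+ r 6 a) ℤ.* σ[ 2 ⨾ 𝟏 , χ₋₄ ] (4 * b + 3)) (pairs n)) / 1))
    × (δ 16 n ≡
    sum (map (λ (a , b) → r 8 a * σ₃# (b + 1)) (pairs n)))
corollary1p8 n =
    r-pairs 2 {4} refl (s≤s (s≤s (s≤s z≤n))) ((+ 1) / 4) 4 n refl refl refl
  , r-pairs 3 {6} refl (s≤s (s≤s (s≤s (s≤s z≤n)))) ((+ 1) / 8) 8 n refl refl refl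
  , sum-pairs 4 {8} refl n (λ b → σ (2 * b + 1)) σ-odd
  , negative-pairs 6 {12} refl n (λ b → σ[ 2 ⨾ 𝟏 , χ₋₄ ] (4 * b + 3)) σ₂-χ
  , sum-pairs 8 {16} refl n (λ b → σ₃# (b + 1)) σ₃#-δ₈
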